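{- Let $\kappa$ be a regular uncountable cardinal. The following are equivalent: (1) There is a $\square^*_{<}(\kappa)$-sequence $\vec C$ such that $R'(\vec C)\cap V'(\vec C)$ contains a club in $\kappa$; (2) $\square^*_{<}(\kappa)$ holds; (3) There is a special $\kappa$-Aronszajn tree.
   Context: A $C$-sequence over $\kappa$ is $\vec C=\langle C_\delta\mid\delta<\kappa\rangle$, each $C_\delta$ a closed subset of $\delta$ with $\sup(C_\delta)=\sup(\delta)$. It is weakly coherent if $|\{C_\delta\cap\epsilon\mid\delta<\kappa\}|<\kappa$ for every $\epsilon<\kappa$. $\mathrm{acc}(\kappa)$: nonzero limit ordinals below $\kappa$; for a set of ordinals $A$, $\mathrm{acc}(A)=\{\alpha\in A\mid\sup(A\cap\alpha)=\alpha>0\}$, $\mathrm{nacc}(A)=A\setminus\mathrm{acc}(A)$. $R(\vec C)=\{\delta\in\mathrm{acc}(\kappa)\mid\forall\alpha\in(\delta,\kappa)\,[\mathrm{otp}(C_\alpha\cap\delta)<\delta]\}$; $R'(\vec C)=\{\delta\in R(\vec C)\mid\mathrm{otp}(C_\delta)<\delta\}$; $V'(\vec C)=\{\delta\in\mathrm{acc}(\kappa)\mid\forall\alpha\in(\delta,\kappa)\,[\sup(\mathrm{nacc}(C_\delta)\cap\mathrm{nacc}(C_\alpha))<\delta]\}$. A $\square^*_{<}(\kappa)$-sequence is a weakly coherent $C$-sequence $\vec C$ over $\kappa$ such that $R(\vec C)$ contains a club; $\square^*_{<}(\kappa)$ asserts that one exists. A $\kappa$-tree is a tree of height $\kappa$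 with levels of size $<\kappa$; $\kappa$-Aronszajn means no chain of size $\kappa$; a $\kappa$-tree $(T,<_T)$ is special iff there is $f:T\to T$ with $f(x)<_Tx$ for non-minimal $x$ and each $f^{ -1}\{z\}$ covered by fewer than $\kappa$ antichains. -}

module Defs where

open import Level using (Level; _⊔_; suc)
open import Data.Nat.Base using (ℕ)
open import Data.Product using (Σ; Σ-syntax; ∃; ∃-syntax; _×_; proj₁)
open import Function.Base using (_on_)
open import Function.Bundles using (Func; Injection; Bijection)
open import Induction.WellFounded using (WellFounded)
open import Relation.Binary.Bundles using (Setoid)
open import Relation.Binary.Core using (Rel)
open import Relation.Binary.Morphism.Structures using (IsOrderIsomorphism)
open import Relation.Binary.PropositionalEquality using (_≡_; setoid)
open import Relation.Binary.Structures using (IsStrictPartialOrder; IsStrictTotalOrder)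
open import Relation.Nullary using (¬_)
open import Relation.Unary using (Pred; _∈_; _∩_; _⊆_; ∁)
open import Relation.Unary.Relation.Binary.Equality using (≐-setoid)
import Relation.Binary.Construct.On as On
import Relation.Binary.Construct.StrictToNonStrict as StrictToNonStrict

record IsWellOrder {a e r} {A : Set a} (_≈_ : Rel A e) (_<_ : Rel A r) : Set (a ⊔ e ⊔ r) where
  field
    isStrictTotalOrder : IsStrictTotalOrder _≈_ _<_
    wellFounded        : WellFounded _<_

-- A subset P of A as a setoid: two elements are equal when they are equal in
-- A, whatever the membership proofs.
⟨_⟩ : ∀ {a p} {A : Set a} → Pred A p → Setoid (a ⊔ p) a
⟨_⟩ {A = A} P = On.setoid {B = Σ A P} (setoid A) proj₁

-- The set { f i ∣ i : I } as a setoid, represented by the indices: i and j are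
-- identified when f i ≈ f j.
image : ∀ {i s e} {I : Set i} (S : Setoid s e) → (I → Setoid.Carrier S) → Setoid i e
image S f = On.setoid S f

-- κ is given by the well-ordered set Ord of the ordinals below it.  An
-- ordinal α < κ is an element of Ord, and is identified with the set ↓ α of
-- its predecessors.
record RegularUncountableCardinal ℓ : Set (suc ℓ) where
  infix 4 _<_
  field
    Ord         : Set ℓ
    _<_         : Rel Ord ℓ
    isWellOrder : IsWellOrder _≡_ _<_

  ↓_ : Ord → Pred Ord ℓ
  (↓ α) β = β < α

  field
    isCardinal    : ∀ α → ¬ Bijection ⟨ ↓ α ⟩ (setoid Ord)
    isUncountable : ¬ Injection (setoid Ord) (setoid ℕ)
    isRegular     : ∀ α (f : Func ⟨ ↓ α ⟩ (setoid Ord)) → ∃[ β ] (∀ η → Func.to f η < β)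

module _ {ℓ : Level} (κ : RegularUncountableCardinal ℓ) where
  open RegularUncountableCardinal κ
  open StrictToNonStrict _≡_ _<_ using (_≤_)

  Size<κ : ∀ {a e} → Setoid a e → Set (ℓ ⊔ a ⊔ e)
  Size<κ S = ∃[ α ] Injection S ⟨ ↓ α ⟩

  -- otp (P , ≺) = γ
  HasOtp : ∀ {a r p} {A : Set a} → Rel A r → Pred A p → Ord → Set (ℓ ⊔ a ⊔ r ⊔ p)
  HasOtp {A = A} _≺_ P γ =
    Σ[ f ∈ (Σ A P → Σ Ord (↓ γ)) ]
      IsOrderIsomorphism (_≡_ on proj₁) (_≡_ on proj₁) (_≺_ on proj₁) (_<_ on proj₁) f

  -- In particular the supremum of the empty set is the least ordinal, 0.
  IsSup : ∀ {p} → Pred Ord p → Ord → Set (ℓ ⊔ p)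
  IsSup A σ = (∀ α → α ∈ A → α ≤ σ) × (∀ τ → (∀ α → α ∈ A → α ≤ τ) → σ ≤ τ)

  -- sup A < δ and otp A < δ
  Sup< Otp< : ∀ {p} → Pred Ord p → Ord → Set (ℓ ⊔ p)
  Sup< A δ = ∃[ σ ] IsSup A σ × σ < δ
  Otp< A δ = ∃[ γ ] HasOtp _<_ A γ × γ < δ

  -- sup (A ∩ α) = α > 0
  LimitPoint : ∀ {p} → Pred Ord p → Ord → Set (ℓ ⊔ p)
  LimitPoint A α = IsSup (A ∩ ↓ α) α × ∃[ β ] β < α

  acc nacc : ∀ {p} → Pred Ord p → Pred Ord (ℓ ⊔ p)
  acc  A = λ α → α ∈ A × LimitPoint A α
  nacc A = A ∩ ∁ (acc A)

  -- acc(κ).  Since κ ∩ δ = ↓ δ, this says sup δ = δ > 0.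
  accκ : Pred Ord ℓ
  accκ δ = IsSup (↓ δ) δ × ∃[ β ] β < δ

  record IsClub (D : Pred Ord ℓ) : Set ℓ where
    field
      closed    : ∀ β → LimitPoint D β → β ∈ D
      unbounded : ∀ α → ∃[ β ] β ∈ D × α < β

  ContainsClub : Pred Ord ℓ → Set (suc ℓ)
  ContainsClub A = ∃[ D ] IsClub D × D ⊆ A

  -- At a successor δ = β + 1 with β > 0, sup-eq says β ∈ C δ; at δ = 1 it
  -- allows C δ to be empty.
  record IsCSequence (C : Ord → Pred Ord ℓ) : Set ℓ where
    field
      subset : ∀ δ → C δ ⊆ ↓ δ
      closed : ∀ δ β → β < δ → LimitPoint (C δ) β → β ∈ C δ
      sup-eq : ∀ δ → ∃[ σ ] IsSup (C δ) σ × IsSup (↓ δ) σ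

  WeaklyCoherent : (Ord → Pred Ord ℓ) → Set ℓ
  WeaklyCoherent C = ∀ ε → Size<κ (image (≐-setoid Ord ℓ) (λ δ → C δ ∩ ↓ ε))

  R R′ V′ : (Ord → Pred Ord ℓ) → Pred Ord ℓ
  R  C δ = δ ∈ accκ × (∀ α → δ < α → Otp< (C α ∩ ↓ δ) δ)
  R′ C δ = δ ∈ R C × Otp< (C δ) δ
  V′ C δ = δ ∈ accκ × (∀ α → δ < α → Sup< (nacc (C δ) ∩ nacc (C α)) δ)

  record IsSquare*<Sequence (C : Ord → Pred Ord ℓ) : Set (suc ℓ) where
    field
      isCSequence    : IsCSequence C
      weaklyCoherent : WeaklyCoherent C
      R-club         : ContainsClub (R C)

  Square*< : Set (suc ℓ)
  Square*< = ∃[ C ] IsSquare*<Sequence C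

  module _ {T : Set ℓ} (_<T_ : Rel T ℓ) where

    Below : T → Pred T ℓ
    Below x y = y <T x

    record IsTree : Set ℓ where
      field
        isStrictPartialOrder : IsStrictPartialOrder _≡_ _<T_
        below-wellOrdered    : ∀ x →
          IsWellOrder {A = Σ T (Below x)} (_≡_ on proj₁) (_<T_ on proj₁)

    TreeLevel : Ord → Pred T ℓ
    TreeLevel α x = HasOtp _<T_ (Below x) α

    -- Height κ: the levels below κ are nonempty, and they exhaust T.
    record IsκTree : Set ℓ where
      field
        isTree      : IsTree
        level-inhab : ∀ α → ∃[ x ] x ∈ TreeLevel α
        level-cover : ∀ x → ∃[ α ] x ∈ TreeLevel α
        level-size  : ∀ α → Size<κ ⟨ TreeLevel α ⟩

    IsChain IsAntichain : Pred T ℓ → Set ℓ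
    IsChain     B = IsStrictTotalOrder {A = Σ T B} (_≡_ on proj₁) (_<T_ on proj₁)
    IsAntichain B = ∀ x y → x ∈ B → y ∈ B → ¬ x <T y

    record IsκAronszajn : Set (suc ℓ) where
      field
        isκTree  : IsκTree
        no-chain : ∀ B → IsChain B → ¬ Bijection ⟨ B ⟩ (setoid Ord)

    -- A union of fewer than κ antichains is one indexed by some ↓ α, α < κ.
    CoveredByFewAntichains : Pred T ℓ → Set (suc ℓ)
    CoveredByFewAntichains P =
      ∃[ α ] Σ[ A ∈ (Ord → Pred T ℓ) ]
        (∀ η → η < α → IsAntichain (A η)) ×
        (∀ x → x ∈ P → ∃[ η ] η < α × x ∈ A η)

    IsSpecial : Set (suc ℓ)
    IsSpecial = Σ[ f ∈ (T → T) ]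
      (∀ x → (∃[ y ] y <T x) → f x <T x) ×
      (∀ z → CoveredByFewAntichains (λ x → f x ≡ z))

  SpecialκAronszajnTree : Set (suc ℓ)
  SpecialκAronszajnTree =
    Σ[ T ∈ Set ℓ ] Σ[ ≺ ∈ Rel T ℓ ] IsκAronszajn ≺ × IsSpecial ≺

-- (2) ⇒ (3).  Let ρ ξ β list the values otp (C βᵢ ∩ ξ) along the walk
-- β = β₀ > β₁ > … > ξ with βᵢ₊₁ = min (C βᵢ ∖ ξ).  The functions ρ (·) β on
-- α + 1, for α ≤ β, form a tree; weak coherence makes its levels small, and
-- ρ (·) β is injective, so the value at the top separates comparable nodes.
-- On the club contained in R the entries of that value lie below the level of
-- the node, which makes the tree special and, by a closure argument, leaves it
-- without cofinal branches.
--
-- (3) ⇒ (1).  Combining the regressive function with the antichains gives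
-- F : T → κ, injective on chains, with F x < ht x on a club E of levels.
-- Choose a node at each level α, and let G γ be the value of F at height γ
-- below it.  For α a limit of E of uncountable cofinality, pressing down
-- yields a least ν < α with G γ < ν for cofinally many γ ∈ E ∩ α.  Then C α is
-- the closure of codes for (node at γ , ν), where γ runs through the strict
-- minima of G on the tails of E ∩ α.  As G increases along these γ,
-- otp (C α) ≤ ν + 1, and C α ∩ ε is determined by ν, by the node at ε and by a
-- cut-off value.  If α has cofinality ω a ladder in E is used, and if α is no
-- limit of E an interval avoiding the limits of E.
--
-- Excluded middle is stated for arbitrary types, so it also provides choice.
module Submission where

open import Defs
open import Axiom.ExcludedMiddle using (ExcludedMiddle)
open import Data.Product using (∃-syntax; _×_)
open import Function.Bundles using (_⇔_)
open import Relation.Unary using (_∩_)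

open import Level using (Level; _⊔_)
open import Data.Empty using (⊥-elim)
open import Data.List.Base using (List; []; _∷_; length)
open import Data.List.Membership.Propositional using () renaming (_∈_ to _∈ˡ_)
open import Data.List.Relation.Unary.Any using (here; there)
open import Data.List.Relation.Unary.All using (All; []; _∷_)
import Data.List.Relation.Unary.All as All
open import Data.List.Properties using (∷-injective)
open import Data.Nat.Base using (ℕ; zero; suc)
import Data.Nat.Base as Nat
import Data.Nat.Properties as Nat
open import Data.Product using (Σ; ∃; Σ-syntax; _,_; proj₁; proj₂)
open import Data.Product.Relation.Binary.Lex.Strict using (×-Lex; ×-wellFounded)
open import Data.Sum.Base using (_⊎_; inj₁; inj₂)
open import Data.Unit.Base using (⊤; tt)
open import Function.Base using (_∘_; _on_; case_of_)
open import Function.Bundles using (Injection; Bijection; mk⇔)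
open import Induction.WellFounded using (WellFounded; Acc; acc; module FixPoint; module Subrelation)
import Induction.WellFounded as WF
open import Relation.Binary.Core using (Rel)
open import Relation.Binary.Bundles using (Setoid)
open import Relation.Binary.Definitions using (Tri; tri<; tri≈; tri>)
open import Relation.Binary.Morphism.Structures using (IsOrderIsomorphism)
open import Relation.Binary.PropositionalEquality using (_≡_; refl; sym; trans; cong; cong₂; subst; subst₂; setoid; isEquivalence; resp₂)
open import Relation.Binary.Structures using (IsStrictPartialOrder; IsStrictTotalOrder)
open import Relation.Nullary using (¬_; Dec; yes; no; contradiction)
open import Relation.Nullary.Decidable using (decidable-stable; recompute)
open import Relation.Unary using (Pred; _⊆_)
open import Relation.Unary.Relation.Binary.Equality using (≐-setoid)
import Relation.Binary.Construct.On as On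
import Relation.Binary.Construct.StrictToNonStrict as StrictToNonStrict

module Development (em : ∀ a → ExcludedMiddle a)
                   {ℓ : Level} (κ : RegularUncountableCardinal ℓ) where

  open RegularUncountableCardinal κ
  open IsWellOrder isWellOrder using (isStrictTotalOrder; wellFounded)
  open IsStrictTotalOrder isStrictTotalOrder using (compare) renaming (trans to <-trans)
  open StrictToNonStrict _≡_ _<_ using (_≤_)

  dec : ∀ {a} (P : Set a) → Dec P
  dec P = em _ {P}

  opaque
    dne : ∀ {a} {P : Set a} → ¬ ¬ P → P
    dne {P = P} = decidable-stable (dec P)

  -- Ordinals below κ

  <-irrefl : ∀ {x} → ¬ x < x
  <-irrefl = IsStrictTotalOrder.irrefl isStrictTotalOrder refl

  ≤-refl : ∀ {x} → x ≤ x
  ≤-refl = inj₂ refl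

  <-≤-trans : ∀ {x y z} → x < y → y ≤ z → x < z
  <-≤-trans p (inj₁ q)    = <-trans p q
  <-≤-trans p (inj₂ refl) = p

  ≤-<-trans : ∀ {x y z} → x ≤ y → y < z → x < z
  ≤-<-trans (inj₁ p)    q = <-trans p q
  ≤-<-trans (inj₂ refl) q = q

  ≤-trans : ∀ {x y z} → x ≤ y → y ≤ z → x ≤ z
  ≤-trans (inj₁ p)    q = inj₁ (<-≤-trans p q)
  ≤-trans (inj₂ refl) q = q

  ≤⇒≯ : ∀ {x y} → x ≤ y → ¬ y < x
  ≤⇒≯ p q = <-irrefl (≤-<-trans p q)

  opaque
    ≮⇒≥ : ∀ {x y} → ¬ x < y → y ≤ x
    ≮⇒≥ {x} {y} ¬p with compare x y
    ... | tri< p _ _    = contradiction p ¬p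
    ... | tri≈ _ refl _ = ≤-refl
    ... | tri> _ _ q    = inj₁ q

  ≰⇒> : ∀ {x y} → ¬ x ≤ y → y < x
  ≰⇒> ¬p = dne λ ¬q → ¬p (≮⇒≥ ¬q)

  ≤-antisym : ∀ {x y} → x ≤ y → y ≤ x → x ≡ y
  ≤-antisym (inj₂ p) _ = p
  ≤-antisym (inj₁ p) q = contradiction p (≤⇒≯ q)

  Least : ∀ {p} → Pred Ord p → Pred Ord (ℓ ⊔ p)
  Least P x = P x × (∀ y → P y → x ≤ y)

  opaque
    least : ∀ {p} (P : Pred Ord p) → ∃ P → ∃ (Least P)
    least P (x , Px) = go x (wellFounded x) Px
      where
      go : ∀ x → Acc _<_ x → P x → ∃ (Least P)
      go x (acc rs) Px with dec (∃[ y ] y < x × P y)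
      ... | yes (y , y<x , Py) = go y (rs y<x) Py
      ... | no none = x , Px , λ y Py → ≮⇒≥ λ y<x → none (y , y<x , Py)

  <-rec : ∀ {p} (P : Pred Ord p) → (∀ x → (∀ {y} → y < x → P y) → P x) → ∀ x → P x
  <-rec P = WF.All.wfRec wellFounded _ P

  increasing⇒≤ : (f : Ord → Ord) → (∀ {x y} → x < y → f x < f y) → ∀ x → x ≤ f x
  increasing⇒≤ f mono = <-rec _ λ x ih → ≮⇒≥ λ fx<x → ≤⇒≯ (ih fx<x) (mono fx<x)

  opaque
    max : ∀ x y → ∃[ z ] x ≤ z × y ≤ z × (∀ u → x < u → y < u → z < u)
    max x y with compare x y
    ... | tri< p _ _    = y , inj₁ p , ≤-refl , λ _ _ q → q
    ... | tri≈ _ refl _ = x , ≤-refl , ≤-refl , λ _ q _ → q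
    ... | tri> _ _ p    = x , ≤-refl , inj₁ p , λ _ q _ → q

  _∨_ : Ord → Ord → Ord
  x ∨ y = proj₁ (max x y)

  ≤-∨ˡ : ∀ x y → x ≤ (x ∨ y)
  ≤-∨ˡ x y = proj₁ (proj₂ (max x y))

  ≤-∨ʳ : ∀ x y → y ≤ (x ∨ y)
  ≤-∨ʳ x y = proj₁ (proj₂ (proj₂ (max x y)))

  ∨-< : ∀ {x y u} → x < u → y < u → (x ∨ y) < u
  ∨-< {x} {y} = proj₂ (proj₂ (proj₂ (max x y))) _

  ∨-≤ : ∀ {x y u} → x ≤ u → y ≤ u → (x ∨ y) ≤ u
  ∨-≤ p q = ≮⇒≥ λ u<m → <-irrefl (∨-< (≤-<-trans p u<m) (≤-<-trans q u<m))

  opaque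
    someOrd : Ord
    someOrd with dec Ord
    ... | yes o = o
    ... | no ¬o = contradiction
      (record { to = ⊥-elim ∘ ¬o ; cong = λ {x} → ⊥-elim (¬o x) ; injective = λ {x} → ⊥-elim (¬o x) })
      isUncountable

  o0 : Ord
  o0 = proj₁ (least (λ _ → ⊤) (someOrd , tt))

  o0≤ : ∀ x → o0 ≤ x
  o0≤ x = proj₂ (proj₂ (least (λ _ → ⊤) (someOrd , tt))) x tt

  >0 : ∀ {x y} → x < y → o0 < y
  >0 = ≤-<-trans (o0≤ _)

  opaque
    unbounded : ∀ α → ∃[ β ] α < β
    unbounded α = dne λ none →
      let ≤α : ∀ β → β ≤ α
          ≤α β = ≮⇒≥ λ α<β → none (β , α<β)
      in case dec (∃[ η ] η < α) of λ
        { (yes (η , η<α)) →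
            let β , bound = isRegular α (record { to = λ _ → α ; cong = λ _ → refl })
            in none (β , bound (η , η<α))
        ; (no ¬η) → isUncountable (record
            { to = λ _ → 0 ; cong = λ _ → refl
            ; injective = λ {x} {y} _ → trans (isα ¬η (≤α x)) (sym (isα ¬η (≤α y))) }) }
      where
      isα : ¬ (∃[ η ] η < α) → ∀ {x} → x ≤ α → x ≡ α
      isα ¬η (inj₁ p) = contradiction (_ , p) ¬η
      isα ¬η (inj₂ p) = p

  opaque
    next : ∀ α → ∃ (Least (α <_))
    next α = least _ (unbounded α)

  s : Ord → Ord
  s α = proj₁ (next α)

  <s : ∀ α → α < s α
  <s α = proj₁ (proj₂ (next α))

  s≤ : ∀ {α β} → α < β → s α ≤ β
  s≤ {α} = proj₂ (proj₂ (next α)) _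

  <s⇒≤ : ∀ {α β} → β < s α → β ≤ α
  <s⇒≤ p = ≮⇒≥ λ q → ≤⇒≯ (s≤ q) p

  ≤⇒<s : ∀ {α β} → β ≤ α → β < s α
  ≤⇒<s p = ≤-<-trans p (<s _)

  s-mono : ∀ {α β} → α < β → s α < s β
  s-mono p = ≤-<-trans (s≤ p) (<s _)

  s-mono-≤ : ∀ {α β} → α ≤ β → s α ≤ s β
  s-mono-≤ (inj₁ p)    = inj₁ (s-mono p)
  s-mono-≤ (inj₂ refl) = ≤-refl

  s-injective : ∀ {α β} → s α ≡ s β → α ≡ β
  s-injective {α} {β} eq with compare α β
  ... | tri< p _ _ = contradiction (subst (_< s β) eq (s-mono p)) <-irrefl
  ... | tri≈ _ p _ = p
  ... | tri> _ _ p = contradiction (subst (s β <_) eq (s-mono p)) <-irrefl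

  0≢s : ∀ {α} → ¬ o0 ≡ s α
  0≢s {α} eq = ≤⇒≯ (o0≤ α) (subst (α <_) (sym eq) (<s α))

  -- Sets of size less than κ

  -- By regularity of κ this expresses size below κ. Boundedness of all functions passes to images
  -- and to unions of few sets without any choice of enumerations.
  Small : ∀ {a p} {X : Set a} → Pred X p → Set (ℓ ⊔ a ⊔ p)
  Small {X = X} P = ∀ (f : X → Ord) → ∃[ β ] ∀ x → P x → f x < β

  module _ {a p} {X : Set a} {P : Pred X p} where

    opaque
      lsub : Small P → (f : X → Ord) → ∃ (Least (λ β → ∀ x → P x → f x < β))
      lsub small f = least _ (small f)

    small-inj : ∀ {b q} {Y : Set b} {Q : Pred Y q} (g : X → Y) →
      (∀ x → P x → Q (g x)) → (∀ x y → P x → P y → g x ≡ g y → x ≡ y) →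
      Small Q → Small P
    small-inj {Y = Y} g into inj small f = proj₁ (small f′) , λ x Px →
      subst (_< _) (f′-g x Px) (proj₂ (small f′) (g x) (into x Px))
      where
      -- `f′` carries `f` along a partial inverse of `g`; the default `o0` off the image is
      -- harmless, as only the values at points `g x` are compared.
      f′ : Y → Ord
      f′ y with dec (∃[ x ] P x × g x ≡ y)
      ... | yes (x , _) = f x
      ... | no _        = o0
      f′-g : ∀ x → P x → f′ (g x) ≡ f x
      f′-g x Px with dec (∃[ x′ ] P x′ × g x′ ≡ g x)
      ... | yes (x′ , Px′ , eq) = cong f (inj x′ x Px′ Px eq)
      ... | no none = contradiction (x , Px , refl) none

    small-⊆ : ∀ {q} {Q : Pred X q} → (∀ x → P x → Q x) → Small Q → Small P
    small-⊆ P⊆Q small f = proj₁ (small f) , λ x Px → proj₂ (small f) x (P⊆Q x Px)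

    small-bind : ∀ {b q} {Y : Set b} {Q : X → Pred Y q} →
      Small P → (∀ x → P x → Small (Q x)) → Small (λ y → ∃[ x ] P x × Q x y)
    small-bind {Q = Q} smallP smallQ f = proj₁ (smallP b) , λ { y (x , Px , Qxy) →
      <-trans (f<b x Px y Qxy) (proj₂ (smallP b) x Px) }
      where
      b : X → Ord
      b x with dec (P x)
      ... | yes Px = proj₁ (smallQ x Px f)
      ... | no _   = o0
      f<b : ∀ x → P x → ∀ y → Q x y → f y < b x
      f<b x Px y Qxy with dec (P x)
      ... | yes Px′ = proj₂ (smallQ x Px′ f) y Qxy
      ... | no ¬Px  = contradiction Px ¬Px

    small-image : ∀ {b} {Y : Set b} (g : X → Y) → Small P → Small (λ y → ∃[ x ] P x × g x ≡ y)
    small-image g small f = proj₁ (small (f ∘ g)) , λ { _ (x , Px , refl) → proj₂ (small (f ∘ g)) x Px }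

    small-∪ : ∀ {q} {Q : Pred X q} → Small P → Small Q → Small (λ x → P x ⊎ Q x)
    small-∪ smallP smallQ f = bp ∨ bq , λ
      { x (inj₁ Px) → <-≤-trans (proj₂ (smallP f) x Px) (≤-∨ˡ bp bq)
      ; x (inj₂ Qx) → <-≤-trans (proj₂ (smallQ f) x Qx) (≤-∨ʳ bp bq) }
      where
      bp = proj₁ (smallP f)
      bq = proj₁ (smallQ f)

  small-↓ : ∀ α → Small (↓ α)
  small-↓ α f =
    let β , bound = isRegular α (record { to = f ∘ proj₁ ; cong = cong f })
    in β , λ x x<α → bound (x , x<α)

  -- Countable sequences and recursive ranks

  nth : ℕ → Ord
  nth zero    = o0
  nth (suc n) = s (nth n)

  increasing : (x : ℕ → Ord) → (∀ n → x n < x (suc n)) → ∀ {m n} → m Nat.< n → x m < x n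
  increasing x step {n = suc n} (Nat.s≤s m≤n) with Nat.m≤n⇒m<n∨m≡n m≤n
  ... | inj₁ m<n  = <-trans (increasing x step m<n) (step n)
  ... | inj₂ refl = step n

  increasing⇒injective : (x : ℕ → Ord) → (∀ n → x n < x (suc n)) → ∀ {m n} → x m ≡ x n → m ≡ n
  increasing⇒injective x step {m} {n} eq with Nat.<-cmp m n
  ... | tri< p _ _ = contradiction (subst (_< x n) eq (increasing x step p)) <-irrefl
  ... | tri≈ _ p _ = p
  ... | tri> _ _ p = contradiction (subst (x n <_) eq (increasing x step p)) <-irrefl

  -- If the finite ordinals exhausted κ, then κ would be countable. Otherwise an ordinal `x` outside
  -- them lies above them all, and `nth` embeds ℕ into `↓ x`.
  small-ℕ : Small {X = ℕ} (λ _ → ⊤)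
  small-ℕ with dec (∀ x → ∃[ n ] nth n ≡ x)
  ... | yes all = contradiction
    (record { to = proj₁ ∘ all ; cong = cong (proj₁ ∘ all)
            ; injective = λ {x} {y} eq → trans (sym (proj₂ (all x))) (trans (cong nth eq) (proj₂ (all y))) })
    isUncountable
  ... | no ¬all = small-inj nth (λ n _ → nth< n)
      (λ m n _ _ → increasing⇒injective nth (λ n → <s (nth n))) (small-↓ x)
    where
    outside : ∃[ x ] ¬ (∃[ n ] nth n ≡ x)
    outside = dne λ none → ¬all λ x → dne λ ¬p → none (x , ¬p)
    x = proj₁ outside
    ≤⇒< : ∀ n → nth n ≤ x → nth n < x
    ≤⇒< n (inj₁ p)  = p
    ≤⇒< n (inj₂ eq) = contradiction (n , eq) (proj₂ outside)
    nth< : ∀ n → nth n < x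
    nth< zero    = ≤⇒< zero (o0≤ x)
    nth< (suc n) = ≤⇒< (suc n) (s≤ (nth< n))

  opaque
    ω-sup : (x : ℕ → Ord) → (∀ n → x n < x (suc n)) →
      ∃[ β ] (∀ n → x n < β) × (∀ η → η < β → ∃[ n ] η < x n)
    ω-sup x step =
      let β , bound , β-least = lsub small-ℕ x
      in β , (λ n → bound n tt) , λ η η<β → dne λ none →
        -- If no term exceeds η, then `x n < x (suc n) ≤ η` makes η a strict bound, against the
        -- leastness of β.
        ≤⇒≯ (β-least η λ n _ → dne λ ¬p → none (suc n , ≤-<-trans (≮⇒≥ ¬p) (step n))) η<β

  opaque
    -- The rank of `x` is the least strict bound of the ranks of its predecessors; as these form a
    -- small set, ranks stay below κ. Both the pairing function and order types arise in this way.
    rank : ∀ {a r} {X : Set a} {_≺_ : Rel X r} → WellFounded _≺_ → (∀ x → Small (_≺ x)) →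
      Σ[ rk ∈ (X → Ord) ]
        (∀ {y x} → y ≺ x → rk y < rk x) ×
        (∀ x β → (∀ y → y ≺ x → rk y < β) → rk x ≤ β)
    rank {X = X} {_≺_} wf small = rk , (λ {y} {x} → rk-< {y} {x}) , rk-≤
      where
      below : ∀ x → (∀ {y} → y ≺ x → Ord) → X → Ord
      below x IH y with dec (y ≺ x)
      ... | yes p = IH p
      ... | no _  = o0

      step : ∀ x → (∀ {y} → y ≺ x → Ord) → Ord
      step x IH = proj₁ (lsub (small x) (below x IH))

      below-ext : ∀ x {IH IH′ : ∀ {y} → y ≺ x → Ord} → (∀ {y} (p : y ≺ x) → IH p ≡ IH′ p) →
        ∀ y → below x IH y ≡ below x IH′ y
      below-ext x eq y with dec (y ≺ x)
      ... | yes p = eq p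
      ... | no _  = refl

      step-≤ : ∀ x {IH IH′ : ∀ {y} → y ≺ x → Ord} → (∀ {y} (p : y ≺ x) → IH p ≡ IH′ p) →
        step x IH ≤ step x IH′
      step-≤ x {IH} {IH′} eq = proj₂ (proj₂ (lsub (small x) (below x IH))) _ λ y y≺x →
        subst (_< step x IH′) (sym (below-ext x eq y))
          (proj₁ (proj₂ (lsub (small x) (below x IH′))) y y≺x)

      -- Unfolding the recursion requires that `step` respect pointwise equality; antisymmetry of
      -- `≤` supplies this without function extensionality.
      module Fix = FixPoint wf (λ _ → Ord) step
        (λ x eq → ≤-antisym (step-≤ x eq) (step-≤ x (λ p → sym (eq p))))

      rk : X → Ord
      rk = WF.All.wfRec wf _ (λ _ → Ord) step

      below-rk : ∀ x y → y ≺ x → below x (λ {y} _ → rk y) y ≡ rk y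
      below-rk x y y≺x with dec (y ≺ x)
      ... | yes _ = refl
      ... | no ¬p = contradiction y≺x ¬p

      rk-< : ∀ {y x} → y ≺ x → rk y < rk x
      rk-< {y} {x} y≺x rewrite Fix.unfold-wfRec {x} =
        subst (_< step x (λ {y} _ → rk y)) (below-rk x y y≺x)
          (proj₁ (proj₂ (lsub (small x) (below x (λ {y} _ → rk y)))) y y≺x)

      rk-≤ : ∀ x β → (∀ y → y ≺ x → rk y < β) → rk x ≤ β
      rk-≤ x β h rewrite Fix.unfold-wfRec {x} =
        proj₂ (proj₂ (lsub (small x) (below x (λ {y} _ → rk y)))) β λ y y≺x →
          subst (_< β) (sym (below-rk x y y≺x)) (h y y≺x)

  -- Codes for pairs and lists of ordinals

  gödelKey : Ord × Ord → Ord × Ord × Ord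
  gödelKey (a , b) = (a ∨ b) , a , b

  -- Gödel's well-order of pairs. Comparing the maxima first leaves each pair with fewer than κ
  -- predecessors.
  _≺ᴳ_ : Rel (Ord × Ord) ℓ
  _≺ᴳ_ = ×-Lex _≡_ _<_ (×-Lex _≡_ _<_ _<_) on gödelKey

  ≺ᴳ-wellFounded : WellFounded _≺ᴳ_
  ≺ᴳ-wellFounded = On.wellFounded gödelKey
    (×-wellFounded wellFounded (×-wellFounded wellFounded wellFounded))

  ≺ᴳ-small : ∀ x → Small (_≺ᴳ x)
  ≺ᴳ-small (a , b) = small-⊆ below
    (small-bind (small-↓ (s (a ∨ b))) λ c _ → small-image (c ,_) (small-↓ (s (a ∨ b))))
    where
    below : ∀ y → y ≺ᴳ (a , b) → ∃[ c ] c < s (a ∨ b) × ∃[ d ] d < s (a ∨ b) × (c , d) ≡ y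
    below (c , d) p = c , ≤⇒<s (≤-trans (≤-∨ˡ c d) (bound p)) , d , ≤⇒<s (≤-trans (≤-∨ʳ c d) (bound p)) , refl
      where
      bound : (c , d) ≺ᴳ (a , b) → (c ∨ d) ≤ (a ∨ b)
      bound (inj₁ q)       = inj₁ q
      bound (inj₂ (q , _)) = inj₂ q

  opaque
    pair : Ord → Ord → Ord
    pair a b = proj₁ (rank ≺ᴳ-wellFounded ≺ᴳ-small) (a , b)

    pair-≺ : ∀ {x y} → x ≺ᴳ y → pair (proj₁ x) (proj₂ x) < pair (proj₁ y) (proj₂ y)
    pair-≺ = proj₁ (proj₂ (rank ≺ᴳ-wellFounded ≺ᴳ-small))

  pair-<ˡ : ∀ {a a′ b} → a < a′ → pair a b < pair a′ b
  pair-<ˡ {a} {a′} {b} p with ∨-≤ (≤-trans (inj₁ p) (≤-∨ˡ a′ b)) (≤-∨ʳ a′ b)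
  ... | inj₁ q = pair-≺ (inj₁ q)
  ... | inj₂ q = pair-≺ (inj₂ (q , inj₁ p))

  ≤-pair : ∀ a b → a ≤ pair a b
  ≤-pair a b = increasing⇒≤ (λ a → pair a b) pair-<ˡ a

  pair-injective : ∀ {a b c d} → pair a b ≡ pair c d → a ≡ c × b ≡ d
  pair-injective {a} {b} {c} {d} eq with compare (a ∨ b) (c ∨ d)
  ... | tri< p _ _ = contradiction (subst (_< _) eq (pair-≺ (inj₁ p))) <-irrefl
  ... | tri> _ _ p = contradiction (subst (_ <_) eq (pair-≺ (inj₁ p))) <-irrefl
  ... | tri≈ _ p _ with compare a c
  ...   | tri< q _ _ = contradiction (subst (_< _) eq (pair-≺ (inj₂ (p , inj₁ q)))) <-irrefl
  ...   | tri> _ _ q = contradiction (subst (_ <_) eq (pair-≺ (inj₂ (sym p , inj₁ q)))) <-irrefl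
  ...   | tri≈ _ q _ with compare b d
  ...     | tri< r _ _ = contradiction (subst (_< _) eq (pair-≺ (inj₂ (p , inj₂ (q , r))))) <-irrefl
  ...     | tri> _ _ r = contradiction (subst (_ <_) eq (pair-≺ (inj₂ (sym p , inj₂ (sym q , r))))) <-irrefl
  ...     | tri≈ _ r _ = q , r

  -- The successor keeps the code of a nonempty list apart from that of `[]`.
  code : List Ord → Ord
  code []      = o0
  code (a ∷ l) = s (pair a (code l))

  code-injective : ∀ {l l′} → code l ≡ code l′ → l ≡ l′
  code-injective {[]}    {[]}     eq = refl
  code-injective {[]}    {_ ∷ _}  eq = contradiction eq 0≢s
  code-injective {_ ∷ _} {[]}     eq = contradiction (sym eq) 0≢s
  code-injective {_ ∷ _} {_ ∷ _}  eq =
    let p , q = pair-injective (s-injective eq) in cong₂ _∷_ p (code-injective q)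

  small-lists : ∀ β → Small (All (_< β))
  small-lists β = small-⊆ (λ l p → length l , tt , p , refl) (small-bind small-ℕ λ n _ → go n)
    where
    go : ∀ n → Small (λ l → All (_< β) l × length l ≡ n)
    go zero f = s (f []) , λ { [] _ → <s _ }
    go (suc n) = small-⊆ (λ { (a ∷ l) (p ∷ ps , refl) → a , p , l , (ps , refl) , refl })
      (small-bind (small-↓ β) λ a _ → small-image (a ∷_) (go n))

  All-<-mono : ∀ {β γ l} → β ≤ γ → All (_< β) l → All (_< γ) l
  All-<-mono p = All.map (λ q → <-≤-trans q p)

  -- Order types

  InitialSegment : ∀ {p} → Pred Ord p → Rel Ord (ℓ ⊔ p)
  InitialSegment P ξ η = P ξ × ξ < η

  module _ {p} (P : Pred Ord p) where

    private
      collapse = rank (Subrelation.wellFounded {_<₁_ = InitialSegment P} proj₂ wellFounded)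
                      (λ x → small-⊆ (λ _ → proj₂) (small-↓ x))

    opaque
      -- col η = otp (P ∩ η)
      col : Ord → Ord
      col = proj₁ collapse

      col-< : ∀ {ξ η} → P ξ → ξ < η → col ξ < col η
      col-< Pξ ξ<η = proj₁ (proj₂ collapse) (Pξ , ξ<η)

      col-≤ : ∀ {η β} → (∀ ξ → P ξ → ξ < η → col ξ < β) → col η ≤ β
      col-≤ h = proj₂ (proj₂ collapse) _ _ λ { ξ (Pξ , ξ<η) → h ξ Pξ ξ<η }

    col-mono : ∀ {η θ} → η ≤ θ → col η ≤ col θ
    col-mono η≤θ = col-≤ λ ξ Pξ ξ<η → col-< Pξ (<-≤-trans ξ<η η≤θ)

    -- An increasing map into θ dominates the collapse `col` pointwise, so the collapse is an
    -- isomorphism onto some γ ≤ θ. The map may depend on the membership proof, because in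
    -- applications it reads off a witness.
    otp-bounded : ∀ {θ} (g : ∀ ξ → P ξ → Ord) →
      (∀ {ξ η} (p : P ξ) (q : P η) → ξ < η → g ξ p < g η q) →
      (∀ ξ p → g ξ p < θ) → ∃[ γ ] HasOtp κ _<_ P γ × γ ≤ θ
    otp-bounded {θ} g mono g<θ = γ , (f , isIso) , γ≤θ
      where
      col≤g : ∀ ξ (p : P ξ) → col ξ ≤ g ξ p
      col≤g = <-rec _ λ η ih q → col-≤ λ ξ p ξ<η → ≤-<-trans (ih ξ<η p) (mono p q ξ<η)

      bound : ∃ (Least (λ β → ∀ ξ → P ξ → col ξ < β))
      bound = least _ (θ , λ ξ p → ≤-<-trans (col≤g ξ p) (g<θ ξ p))

      γ = proj₁ bound

      γ≤θ : γ ≤ θ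
      γ≤θ = proj₂ (proj₂ bound) θ λ ξ p → ≤-<-trans (col≤g ξ p) (g<θ ξ p)

      f : Σ Ord P → Σ Ord (↓ γ)
      f (ξ , p) = col ξ , proj₁ (proj₂ bound) ξ p

      cancel : ∀ {ξ η} → P ξ → P η → col ξ < col η → ξ < η
      cancel {ξ} {η} p q c with compare ξ η
      ... | tri< r _ _    = r
      ... | tri≈ _ refl _ = contradiction c <-irrefl
      ... | tri> _ _ r    = contradiction c (≤⇒≯ (inj₁ (col-< q r)))

      injective : ∀ {ξ η} → P ξ → P η → col ξ ≡ col η → ξ ≡ η
      injective {ξ} {η} p q c with compare ξ η
      ... | tri< r _ _ = contradiction (subst (_< col η) c (col-< p r)) <-irrefl
      ... | tri≈ _ r _ = r
      ... | tri> _ _ r = contradiction (subst (col η <_) c (col-< q r)) <-irrefl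

      onto : ∀ η → η < γ → ∃[ ξ ] P ξ × col ξ ≡ η
      onto η η<γ =
        -- The least point of `P` with collapse at least η attains η, since all earlier points of
        -- `P` have collapse below η.
        let ξ , (Pξ , η≤c) , ξ-least = least (λ ξ → P ξ × η ≤ col ξ) (dne λ none →
              ≤⇒≯ (proj₂ (proj₂ bound) η λ ξ p → dne λ ¬c → none (ξ , p , ≮⇒≥ ¬c)) η<γ)
        in ξ , Pξ , ≤-antisym (col-≤ λ ζ Pζ ζ<ξ → dne λ ¬c →
             ≤⇒≯ (ξ-least ζ (Pζ , ≮⇒≥ ¬c)) ζ<ξ) η≤c

      isIso : IsOrderIsomorphism _ _ _ _ f
      isIso = record
        { isOrderMonomorphism = record
          { isOrderHomomorphism = record
            { cong = cong col
            ; mono = λ {x} {y} → col-< (proj₂ x)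
            }
          ; injective = λ {x} {y} → injective (proj₂ x) (proj₂ y)
          ; cancel = λ {x} {y} → cancel (proj₂ x) (proj₂ y)
          }
        ; surjective = λ { (η , η<γ) → let ξ , Pξ , eq = onto η η<γ in
            (ξ , Pξ) , λ e → trans (cong col e) eq }
        }

  col-⊆ : ∀ {p q} {P : Pred Ord p} {Q : Pred Ord q} η → (∀ {ξ} → ξ < η → P ξ → Q ξ) → col P η ≤ col Q η
  col-⊆ {P = P} {Q} = <-rec _ λ η ih P⊆Q → col-≤ P λ ξ Pξ ξ<η →
    ≤-<-trans (ih ξ<η λ ζ<ξ → P⊆Q (<-trans ζ<ξ ξ<η)) (col-< Q (P⊆Q ξ<η Pξ) ξ<η)

  col-cong : ∀ {p q} {P : Pred Ord p} {Q : Pred Ord q} {η} →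
    (∀ {ξ} → ξ < η → P ξ → Q ξ) → (∀ {ξ} → ξ < η → Q ξ → P ξ) → col P η ≡ col Q η
  col-cong P⊆Q Q⊆P = ≤-antisym (col-⊆ _ P⊆Q) (col-⊆ _ Q⊆P)

  HasOtp⇒col≤ : ∀ {p} (P : Pred Ord p) {δ γ} → HasOtp κ _<_ (P ∩ ↓ δ) γ → col P δ ≤ γ
  HasOtp⇒col≤ P {δ} {γ} (f , iso) = col-≤ P λ ξ Pξ ξ<δ →
    ≤-<-trans (col≤f ξ (Pξ , ξ<δ)) (proj₂ (f (ξ , Pξ , ξ<δ)))
    where
    open IsOrderIsomorphism iso
    col≤f : ∀ ξ p → col P ξ ≤ proj₁ (f (ξ , p))
    col≤f = <-rec _ λ η ih q → col-≤ P λ ξ Pξ ξ<η →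
      let p = Pξ , <-trans ξ<η (proj₂ q) in ≤-<-trans (ih ξ<η p) (mono ξ<η)

  -- By induction on values, `f` is nowhere above `f′`. If γ′ < γ, the point that `f` sends to γ′
  -- would be sent by `f′` to a value outside `↓ γ′`.
  HasOtp-≤ : ∀ {a r p} {A : Set a} {_≺_ : Rel A r} {P : Pred A p} {γ γ′} →
    HasOtp κ _≺_ P γ → HasOtp κ _≺_ P γ′ → γ ≤ γ′
  HasOtp-≤ {A = A} {_≺_} {P} {γ} {γ′} (f , iso) (f′ , iso′) = ≮⇒≥ λ γ′<γ →
    let w , eq = F.surjective (γ′ , γ′<γ)
    in ≤⇒≯ (subst (_≤ proj₁ (f′ w)) (eq refl) (f≤f′ (proj₁ (f w)) w refl)) (proj₂ (f′ w))
    where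
    module F  = IsOrderIsomorphism iso
    module F′ = IsOrderIsomorphism iso′
    f≤f′ : ∀ ξ z → proj₁ (f z) ≡ ξ → ξ ≤ proj₁ (f′ z)
    f≤f′ = <-rec _ λ ξ ih z eq → ≮⇒≥ λ f′z<ξ →
      let fz<γ = proj₂ (f z)
          w , e = F.surjective (proj₁ (f′ z) , <-trans (subst (proj₁ (f′ z) <_) (sym eq) f′z<ξ) fz<γ)
          fw≡f′z = e refl
          fw<fz = subst (λ u → proj₁ (f w) < u) (sym eq) (subst (_< ξ) (sym fw≡f′z) f′z<ξ)
      in ≤⇒≯ (ih f′z<ξ w fw≡f′z) (F′.mono (F.cancel fw<fz))

  HasOtp-unique : ∀ {a r p} {A : Set a} {_≺_ : Rel A r} {P : Pred A p} {γ γ′} →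
    HasOtp κ _≺_ P γ → HasOtp κ _≺_ P γ′ → γ ≡ γ′
  HasOtp-unique p q = ≤-antisym (HasOtp-≤ p q) (HasOtp-≤ q p)

  -- Limit points and clubs

  opaque
    isSup : ∀ {p} {A : Pred Ord p} {η} → (∀ ξ → A ξ → ξ ≤ η) → ∃[ σ ] IsSup κ A σ × σ ≤ η
    isSup h = let σ , ub , σ-least = least _ (_ , h) in σ , (ub , σ-least) , σ-least _ h

  opaque
    LimitPoint⁺ : ∀ {p} {A : Pred Ord p} {α} → o0 < α →
      (∀ η → η < α → ∃[ ξ ] A ξ × η < ξ × ξ < α) → LimitPoint κ A α
    LimitPoint⁺ 0<α h = ((λ _ → inj₁ ∘ proj₂) , λ τ ub → ≮⇒≥ λ τ<α →
      let ξ , Aξ , τ<ξ , ξ<α = h τ τ<α in ≤⇒≯ (ub ξ (Aξ , ξ<α)) τ<ξ) , o0 , 0<α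

  opaque
    LimitPoint⁻ : ∀ {p} {A : Pred Ord p} {α} → LimitPoint κ A α →
      ∀ η → η < α → ∃[ ξ ] A ξ × η < ξ × ξ < α
    LimitPoint⁻ ((_ , α-least) , _) η η<α = dne λ none →
      ≤⇒≯ (α-least η λ { ξ (Aξ , ξ<α) → ≮⇒≥ λ η<ξ → none (ξ , Aξ , η<ξ , ξ<α) }) η<α

  LimitPoint>0 : ∀ {p} {A : Pred Ord p} {α} → LimitPoint κ A α → o0 < α
  LimitPoint>0 (_ , _ , p) = >0 p

  opaque
    LimitPoint-⊆ : ∀ {p q} {A : Pred Ord p} {B : Pred Ord q} {α} →
      (∀ ξ → ξ < α → A ξ → B ξ) → LimitPoint κ A α → LimitPoint κ B α
    LimitPoint-⊆ A⊆B lp = LimitPoint⁺ (LimitPoint>0 lp) λ η η<α →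
      let ξ , Aξ , η<ξ , ξ<α = LimitPoint⁻ lp η η<α in ξ , A⊆B ξ ξ<α Aξ , η<ξ , ξ<α

  opaque
    LimitPoint-idem : ∀ {p} {A : Pred Ord p} {α} → LimitPoint κ (LimitPoint κ A) α → LimitPoint κ A α
    LimitPoint-idem lp = LimitPoint⁺ (LimitPoint>0 lp) λ η η<α →
      let ξ , lpξ , η<ξ , ξ<α = LimitPoint⁻ lp η η<α
          ζ , Aζ , η<ζ , ζ<ξ = LimitPoint⁻ lpξ η η<ξ
      in ζ , Aζ , η<ζ , <-trans ζ<ξ ξ<α

  LimitPoint⇒accκ : ∀ {p} {A : Pred Ord p} {α} → LimitPoint κ A α → accκ κ α
  LimitPoint⇒accκ lp = ((λ _ → inj₁) , λ τ ub → ≮⇒≥ λ τ<α →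
    let ξ , _ , τ<ξ , ξ<α = LimitPoint⁻ lp τ τ<α in ≤⇒≯ (ub ξ ξ<α) τ<ξ) , o0 , LimitPoint>0 lp

  module _ {p q} {Q : Pred Ord p} {S : Rel Ord q}
           (start : ∃ Q) (step : ∀ x → Q x → ∃[ y ] Q y × S x y) where

    private
      sequence : ℕ → ∃ Q
      sequence zero    = start
      sequence (suc n) = let x , Qx = sequence n ; y , Qy , _ = step x Qx in y , Qy

    opaque
      dependentChoice : Σ[ x ∈ (ℕ → Ord) ] x 0 ≡ proj₁ start × (∀ n → Q (x n)) × (∀ n → S (x n) (x (suc n)))
      dependentChoice = proj₁ ∘ sequence , refl , proj₂ ∘ sequence ,
        λ n → proj₂ (proj₂ (step (proj₁ (sequence n)) (proj₂ (sequence n))))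

  opaque
    -- The supremum of an ω-chain in `D` in which each term bounds `h` on the ordinals below the
    -- preceding term.
    closurePoint : ∀ {p} {D : Pred Ord p} → (∀ α → ∃[ β ] D β × α < β) → (h : Ord → Ord) →
      ∀ α → ∃[ δ ] α < δ × LimitPoint κ D δ × (∀ γ → γ < δ → h γ < δ)
    closurePoint {D = D} unb h α =
      let start = (let β , Dβ , α<β = unb α in β , Dβ)
          x , x0 , xD , xS = dependentChoice {Q = D} {S = S} start step
          δ , x<δ , cofinal = ω-sup x (proj₁ ∘ xS)
          α<δ = <-trans (subst (α <_) (sym x0) (proj₂ (proj₂ (unb α)))) (x<δ 0)
      in δ , α<δ
       , LimitPoint⁺ (>0 α<δ) (λ η η<δ → let n , η<xn = cofinal η η<δ in x n , xD n , η<xn , x<δ n)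
       , λ γ γ<δ → let n , γ<xn = cofinal γ γ<δ in <-trans (proj₂ (xS n) γ γ<xn) (x<δ (suc n))
      where
      S : Rel Ord ℓ
      S x y = x < y × (∀ γ → γ < x → h γ < y)
      step : ∀ x → D x → ∃[ y ] D y × S x y
      step x _ =
        let b , bound = small-↓ x h
            y , Dy , m<y = unb (x ∨ b)
        in y , Dy , ≤-<-trans (≤-∨ˡ x b) m<y , λ γ γ<x →
             <-trans (bound γ γ<x) (≤-<-trans (≤-∨ʳ x b) m<y)

  -- A finite list below δ has its maximum below δ. The bound `s γ` on the entries, with only γ
  -- below δ, avoids any assumption that δ is a limit.
  All-<-limit : ∀ {δ l} → o0 < δ → All (_< δ) l → ∃[ γ ] γ < δ × All (_< s γ) l
  All-<-limit 0<δ []       = o0 , 0<δ , []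
  All-<-limit 0<δ (p ∷ ps) =
    let γ , γ<δ , qs = All-<-limit 0<δ ps
    in _ , ∨-< p γ<δ , ≤⇒<s (≤-∨ˡ _ γ) ∷ All-<-mono (s-mono-≤ (≤-∨ʳ _ γ)) qs

  -- From square sequences to special trees

  module SquareToTree {C : Ord → Pred Ord ℓ} (square : IsSquare*<Sequence κ C) where
    open IsSquare*<Sequence square
    open IsCSequence isCSequence

    D : Pred Ord ℓ
    D = proj₁ R-club

    D⊆R : D ⊆ R κ C
    D⊆R = proj₂ (proj₂ R-club)

    open IsClub (proj₁ (proj₂ R-club)) renaming (closed to D-closed; unbounded to D-unbounded)

    D>0 : ∀ {δ} → D δ → o0 < δ
    D>0 Dδ = >0 (proj₂ (proj₂ (proj₁ (D⊆R Dδ))))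

    -- This differs from C only in that C⁺ 1 = { 0 }.
    C⁺ : Ord → Pred Ord ℓ
    C⁺ β ξ = C β ξ ⊎ β ≡ s ξ

    C⁺-< : ∀ {β ξ} → C⁺ β ξ → ξ < β
    C⁺-< (inj₁ p)    = subset _ p
    C⁺-< (inj₂ refl) = <s _

    -- If no point of `C β` is at or above α, then the supremum σ of `↓ β` is below β. Hence β is
    -- the successor of σ, and σ is the point that `C⁺` adds.
    C⁺-cofinal : ∀ {α β} → α < β → ∃[ ξ ] C⁺ β ξ × α ≤ ξ
    C⁺-cofinal {α} {β} α<β with sup-eq β
    ... | σ , (_ , σ-least) , (ub , _) = dne λ none →
      let σ<β = ≤-<-trans (σ-least α λ ξ Cξ → ≮⇒≥ λ α<ξ → none (ξ , inj₁ Cξ , inj₁ α<ξ)) α<β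
          β≡sσ = ≤-antisym (≮⇒≥ λ sσ<β → ≤⇒≯ (ub _ sσ<β) (<s σ)) (s≤ σ<β)
      in none (σ , inj₂ β≡sσ , <s⇒≤ (subst (α <_) β≡sσ α<β))

    -- Walks on ordinals

    Next : Ord → Ord → Pred Ord ℓ
    Next α β = Least (λ ξ → C⁺ β ξ × α ≤ ξ)

    Next-exists : ∀ {α β} → α < β → ∃ (Next α β)
    Next-exists α<β = least _ (C⁺-cofinal α<β)

    Next-unique : ∀ {α β ξ ξ′} → Next α β ξ → Next α β ξ′ → ξ ≡ ξ′
    Next-unique (p , least-p) (q , least-q) = ≤-antisym (least-p _ q) (least-q _ p)

    -- The walk steps through `C⁺`, but the recorded order types are those of `C`, to which the
    -- bounds from `R` apply.
    data Walk (α : Ord) : Ord → List Ord → Set ℓ where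
      stop : Walk α α []
      step : ∀ {β β′ l} → α < β → Next α β β′ → Walk α β′ l → Walk α β (col (C β) α ∷ l)

    walk : ∀ α β → α ≤ β → ∃ (Walk α β)
    walk α = <-rec _ go
      where
      go : ∀ β → (∀ {β′} → β′ < β → α ≤ β′ → ∃ (Walk α β′)) → α ≤ β → ∃ (Walk α β)
      go β ih (inj₂ refl) = [] , stop
      go β ih (inj₁ α<β)  =
        let β′ , n = Next-exists α<β
            (Cβ′ , α≤β′) , _ = n
            l , w = ih (C⁺-< Cβ′) α≤β′
        in _ ∷ l , step α<β n w

    walk-deterministic : ∀ {α β l l′} → Walk α β l → Walk α β l′ → l ≡ l′
    walk-deterministic stop stop = refl
    walk-deterministic stop (step p _ _) = contradiction p <-irrefl
    walk-deterministic (step p _ _) stop = contradiction p <-irrefl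
    walk-deterministic (step _ n w) (step _ n′ w′) with Next-unique n n′
    ... | refl = cong (_ ∷_) (walk-deterministic w w′)

    -- Equal first entries mean that `C β` has no point in the interval from α to α′. Both walks
    -- then step to the same ordinal, and induction applies to the rest.
    walk-distinct : ∀ {α α′ β l l′} → α < α′ → Walk α β l → Walk α′ β l′ → ¬ l ≡ l′
    walk-distinct α<α stop stop refl = <-irrefl α<α
    walk-distinct {α} {α′} {β} α<α′ (step {β′ = ξ} _ ((Cξ , α≤ξ) , ξ-least) w) (step {β′ = ξ′} α′<β n′ w′) eq =
      walk-distinct α<α′ w (subst (λ ζ → Walk α′ ζ _) (sym ξ≡ξ′) w′) (proj₂ (∷-injective eq))
      where
      skip : ∀ {ζ} → C⁺ β ζ → α ≤ ζ → α′ ≤ ζ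
      skip (inj₂ refl) _  = <s⇒≤ α′<β
      skip (inj₁ Cζ) α≤ζ = ≮⇒≥ λ ζ<α′ → <-irrefl
        (subst (_< col (C β) α′) (proj₁ (∷-injective eq))
          (≤-<-trans (col-mono (C β) α≤ζ) (col-< (C β) Cζ ζ<α′)))
      ξ≡ξ′ : ξ ≡ ξ′
      ξ≡ξ′ = Next-unique ((Cξ , skip Cξ α≤ξ) , λ { ζ (Cζ , α′≤ζ) →
        ξ-least ζ (Cζ , ≤-trans (inj₁ α<α′) α′≤ζ) }) n′

    -- Every ordinal from which the walk takes a step exceeds δ, so δ ∈ `R` bounds the order type
    -- recorded there.
    walk-bounded : ∀ {δ β l} → D δ → Walk δ β l → All (_< δ) l
    walk-bounded Dδ stop = []
    walk-bounded Dδ (step δ<β _ w) with proj₂ (D⊆R Dδ) _ δ<β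
    ... | γ , otp , γ<δ = ≤-<-trans (HasOtp⇒col≤ (C _) otp) γ<δ ∷ walk-bounded Dδ w

    ρ : Ord → Ord → List Ord
    ρ ξ β with dec (ξ ≤ β)
    ... | yes p = proj₁ (walk ξ β p)
    ... | no _  = []

    ρ-walk : ∀ {ξ β} → ξ ≤ β → Walk ξ β (ρ ξ β)
    ρ-walk {ξ} {β} ξ≤β with dec (ξ ≤ β)
    ... | yes p = proj₂ (walk ξ β p)
    ... | no ¬p = contradiction ξ≤β ¬p

    -- Agreement of walks and the size of levels

    Agree : Ord → Rel Ord ℓ
    Agree α β β′ = ∀ ξ → ξ ≤ α → ρ ξ β ≡ ρ ξ β′

    Agree-sym : ∀ {α β β′} → Agree α β β′ → Agree α β′ β
    Agree-sym p ξ q = sym (p ξ q)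

    Agree-trans : ∀ {α β β′ β″} → Agree α β β′ → Agree α β′ β″ → Agree α β β″
    Agree-trans p q ξ r = trans (p ξ r) (q ξ r)

    Agree-≤ : ∀ {α α′ β β′} → α′ ≤ α → Agree α β β′ → Agree α′ β β′
    Agree-≤ α′≤α p ξ q = p ξ (≤-trans q α′≤α)

    -- The class of β modulo Agree α is determined by the sets C β ∩ (α + 1)
    -- met by the walk from β to α.
    module Trace (α : Ord) where

      private
        μ = proj₁ (weaklyCoherent (s α))
        module I = Injection (proj₂ (weaklyCoherent (s α)))

      -- The extra value μ is reserved for `s α`, the only β above α at which `C⁺` can add a point
      -- that is at most α.
      index : Ord → Ord
      index β with dec (β ≡ s α)
      ... | yes _ = μ
      ... | no _  = proj₁ (I.to β)

      index-< : ∀ β → index β < s μ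
      index-< β with dec (β ≡ s α)
      ... | yes _ = <s μ
      ... | no _  = <-trans (proj₂ (I.to β)) (<s μ)

      index-C⁺ : ∀ {β β′} → index β ≡ index β′ → ∀ {ξ} → ξ ≤ α → α < β → C⁺ β ξ → C⁺ β′ ξ
      index-C : ∀ {β β′} → index β ≡ index β′ → ∀ {ξ} → ξ ≤ α → C β ξ → C β′ ξ
      index-C⁺ eq ξ≤α α<β (inj₁ Cξ) = inj₁ (index-C eq ξ≤α Cξ)
      index-C⁺ {β′ = β′} eq ξ≤α α<β (inj₂ refl) with ≤-antisym ξ≤α (<s⇒≤ α<β)
      ... | refl with dec (s α ≡ s α) | dec (β′ ≡ s α)
      ...   | yes _ | yes p = inj₂ p
      ...   | yes _ | no _  = contradiction (subst (_< μ) (sym eq) (proj₂ (I.to β′))) <-irrefl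
      ...   | no ¬p | _     = contradiction refl ¬p
      index-C {β} {β′} eq ξ≤α Cξ with dec (β ≡ s α) | dec (β′ ≡ s α)
      ... | yes refl | yes refl = Cξ
      ... | yes _    | no _     = contradiction (subst (_< μ) (sym eq) (proj₂ (I.to β′))) <-irrefl
      ... | no _     | yes _    = contradiction (subst (_< μ) eq (proj₂ (I.to β))) <-irrefl
      ... | no _     | no _     = proj₁ (proj₁ (I.injective eq) (Cξ , ≤⇒<s ξ≤α))

      data Trace : Ord → List Ord → Set ℓ where
        stop : Trace α []
        step : ∀ {β β′ l} → α < β → Next α β β′ → Trace β′ l → Trace β (index β ∷ l)

      trace : ∀ β → α ≤ β → ∃ (Trace β)
      trace = <-rec _ go
        where
        go : ∀ β → (∀ {β′} → β′ < β → α ≤ β′ → ∃ (Trace β′)) → α ≤ β → ∃ (Trace β)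
        go β ih (inj₂ refl) = [] , stop
        go β ih (inj₁ α<β)  =
          let β′ , n = Next-exists α<β
              (Cβ′ , α≤β′) , _ = n
              l , t = ih (C⁺-< Cβ′) α≤β′
          in _ ∷ l , step α<β n t

      trace-bounded : ∀ {β l} → Trace β l → All (_< s μ) l
      trace-bounded stop         = []
      trace-bounded (step _ _ t) = index-< _ ∷ trace-bounded t

      -- While the walk to ξ stays above α it coincides with the walk to α, so the walks from β and
      -- β̂ descend in parallel. The first step to a point at or below α is the same for both, by
      -- equality of the indices, and from there the walks are identical.
      trace-walk : ∀ {β β̂ L L̂ ξ l} → Trace β L → Trace β̂ L̂ → L ≡ L̂ → ξ ≤ α → Walk ξ β l → Walk ξ β̂ l
      trace-walk stop stop _ _ w = w
      trace-walk (step α<β _ _) (step _ _ _) _ ξ≤α stop = contradiction α<β (≤⇒≯ ξ≤α)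
      trace-walk {ξ = ξ} (step {β} {β′} α<β n t) (step {β̂} {β̂′} α<β̂ n̂ t̂) eq ξ≤α
                 (step {β′ = β₁} {l} ξ<β ((Cβ₁ , ξ≤β₁) , β₁-least) w) =
        subst (λ c → Walk ξ β̂ (c ∷ l)) (sym col≡) (step (≤-<-trans ξ≤α α<β̂) (proj₁ (proj₂ next̂)) (proj₂ (proj₂ next̂)))
        where
        eq₁ = proj₁ (∷-injective eq)

        col≡ : col (C β) ξ ≡ col (C β̂) ξ
        col≡ = col-cong (λ ζ<ξ → index-C eq₁ (inj₁ (<-≤-trans ζ<ξ ξ≤α)))
                        (λ ζ<ξ → index-C (sym eq₁) (inj₁ (<-≤-trans ζ<ξ ξ≤α)))

        next̂ : ∃[ ζ ] Next ξ β̂ ζ × Walk ξ ζ l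
        next̂ with dec (β₁ ≤ α)
        ... | yes β₁≤α = β₁ , ((index-C⁺ eq₁ β₁≤α α<β Cβ₁ , ξ≤β₁) , minimal) , w
          where
          minimal : ∀ ζ → C⁺ β̂ ζ × ξ ≤ ζ → β₁ ≤ ζ
          minimal ζ (Cζ , ξ≤ζ) with dec (ζ ≤ α)
          ... | yes ζ≤α = β₁-least ζ (index-C⁺ (sym eq₁) ζ≤α α<β̂ Cζ , ξ≤ζ)
          ... | no ζ≰α  = ≤-trans β₁≤α (inj₁ (≰⇒> ζ≰α))
        ... | no β₁≰α = β̂′ , ((proj₁ (proj₁ n̂) , ≤-trans ξ≤α (proj₂ (proj₁ n̂))) , minimal)
                      , trace-walk t t̂ (proj₂ (∷-injective eq)) ξ≤α
                          (subst (λ ζ → Walk ξ ζ l) (Next-unique next-α n) w)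
          where
          next-α : Next α β β₁
          next-α = (Cβ₁ , inj₁ (≰⇒> β₁≰α)) , λ { ζ (Cζ , α≤ζ) → β₁-least ζ (Cζ , ≤-trans ξ≤α α≤ζ) }
          minimal : ∀ ζ → C⁺ β̂ ζ × ξ ≤ ζ → β̂′ ≤ ζ
          minimal ζ (Cζ , ξ≤ζ) with dec (ζ ≤ α)
          ... | yes ζ≤α = contradiction
                (≤-trans (β₁-least ζ (index-C⁺ (sym eq₁) ζ≤α α<β̂ Cζ , ξ≤ζ)) ζ≤α) β₁≰α
          ... | no ζ≰α  = proj₂ n̂ ζ (Cζ , inj₁ (≰⇒> ζ≰α))

      traceOf : Ord → List Ord
      traceOf β with dec (α ≤ β)
      ... | yes p = proj₁ (trace β p)
      ... | no _  = []

      traceOf-bounded : ∀ β → All (_< s μ) (traceOf β)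
      traceOf-bounded β with dec (α ≤ β)
      ... | yes p = trace-bounded (proj₂ (trace β p))
      ... | no _  = []

      traceOf-trace : ∀ {β} → α ≤ β → Trace β (traceOf β)
      traceOf-trace {β} α≤β with dec (α ≤ β)
      ... | yes p = proj₂ (trace β p)
      ... | no ¬p = contradiction α≤β ¬p

      traceOf-Agree : ∀ {β β′} → α ≤ β → α ≤ β′ → traceOf β ≡ traceOf β′ → Agree α β β′
      traceOf-Agree α≤β α≤β′ eq ξ ξ≤α = walk-deterministic
        (trace-walk (traceOf-trace α≤β) (traceOf-trace α≤β′) eq ξ≤α (ρ-walk (≤-trans ξ≤α α≤β)))
        (ρ-walk (≤-trans ξ≤α α≤β′))

      few : ∃[ ν ] ∀ β → code (traceOf β) < ν
      few = let ν , bound = small-lists (s μ) code in ν , λ β → bound _ (traceOf-bounded β)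

    -- The tree of the functions ρ (·) β restricted to α + 1, at level α, each
    -- represented by the least such β
    IsRep : Ord → Pred Ord ℓ
    IsRep α β = Least (λ β′ → α ≤ β′ × Agree α β′ β) β

    -- With the proof irrelevant, a node is determined by `lvl` and `rep`; decidability recovers the
    -- proof in `isRep`.
    record Node : Set ℓ where
      field
        lvl rep : Ord
        .isRep′ : IsRep lvl rep

    open Node

    isRep : ∀ x → IsRep (lvl x) (rep x)
    isRep record { isRep′ = p } = recompute (dec _) p

    lvl≤rep : ∀ x → lvl x ≤ rep x
    lvl≤rep x = proj₁ (proj₁ (isRep x))

    Node-≡ : ∀ {x y} → lvl x ≡ lvl y → Agree (lvl x) (rep x) (rep y) → x ≡ y
    Node-≡ {x} {y} refl agree = go (≤-antisym
        (proj₂ (isRep x) _ (lvl≤rep y , Agree-sym agree))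
        (proj₂ (isRep y) _ (lvl≤rep x , agree)))
      where
      go : rep x ≡ rep y → x ≡ y
      go refl = refl

    node : ∀ α β → α ≤ β → Σ[ x ∈ Node ] lvl x ≡ α × Agree α (rep x) β
    node α β α≤β =
      let β′ , (α≤β′ , agree) , β′-least = least (λ β′ → α ≤ β′ × Agree α β′ β) (β , α≤β , λ _ _ → refl)
      in record { lvl = α ; rep = β′
                ; isRep′ = (α≤β′ , λ _ _ → refl) , λ { γ (α≤γ , q) → β′-least γ (α≤γ , Agree-trans q agree) } }
       , refl , agree

    record _<T_ (x y : Node) : Set ℓ where
      constructor _,_
      field
        lvl-<  : lvl x < lvl y
        agrees : Agree (lvl x) (rep x) (rep y)

    open _<T_

    restrict : ∀ x {τ} → τ < lvl x → Σ[ y ∈ Node ] lvl y ≡ τ × y <T x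
    restrict x τ<x with node _ (rep x) (≤-trans (inj₁ τ<x) (lvl≤rep x))
    ... | y , refl , agree = y , refl , (τ<x , agree)

    <T-trans : ∀ {x y z} → x <T y → y <T z → x <T z
    <T-trans (p , q) (p′ , q′) = <-trans p p′ , Agree-trans q (Agree-≤ (inj₁ p) q′)

    below-< : ∀ {x y z} → x <T z → y <T z → lvl x < lvl y → x <T y
    below-< (_ , p) (_ , q) r = r , Agree-trans p (Agree-≤ (inj₁ r) (Agree-sym q))

    below-≡ : ∀ {x y z} → x <T z → y <T z → lvl x ≡ lvl y → x ≡ y
    below-≡ (_ , p) (_ , q) r = Node-≡ r (Agree-trans p (Agree-≤ (inj₂ r) (Agree-sym q)))

    <T-isStrictPartialOrder : IsStrictPartialOrder _≡_ _<T_
    <T-isStrictPartialOrder = record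
      { isEquivalence = isEquivalence
      ; irrefl = λ { refl p → <-irrefl (lvl-< p) }
      ; trans = <T-trans
      ; <-resp-≈ = resp₂ _<T_
      }

    <T-isTree : IsTree κ _<T_
    <T-isTree = record
      { isStrictPartialOrder = <T-isStrictPartialOrder
      ; below-wellOrdered = λ x → record
        { isStrictTotalOrder = record
          { isStrictPartialOrder = On.isStrictPartialOrder proj₁ <T-isStrictPartialOrder
          ; compare = λ { (y , y<x) (z , z<x) → below-compare y<x z<x }
          }
        ; wellFounded = On.wellFounded proj₁ (Subrelation.wellFounded lvl-< (On.wellFounded lvl wellFounded))
        }
      }
      where
      below-compare : ∀ {x y z} → y <T x → z <T x → Tri (y <T z) (y ≡ z) (z <T y)
      below-compare {x} {y} {z} y<x z<x with compare (lvl y) (lvl z)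
      ... | tri< p ¬q ¬r = tri< (below-< y<x z<x p) (¬q ∘ cong lvl) (¬r ∘ lvl-<)
      ... | tri≈ ¬p q ¬r = tri≈ (¬p ∘ lvl-<) (below-≡ y<x z<x q) (¬r ∘ lvl-<)
      ... | tri> ¬p ¬q r = tri> (¬p ∘ lvl-<) (¬q ∘ cong lvl) (below-< z<x y<x r)

    onLevel : ∀ x → TreeLevel κ _<T_ (lvl x) x
    onLevel x = (λ { (y , y<x) → lvl y , lvl-< y<x }) , record
      { isOrderMonomorphism = record
        { isOrderHomomorphism = record { cong = cong lvl ; mono = lvl-< }
        ; injective = λ {y} {z} → below-≡ (proj₂ y) (proj₂ z)
        ; cancel = λ {y} {z} → below-< (proj₂ y) (proj₂ z)
        }
      ; surjective = λ { (τ , τ<x) → let y , eq , y<x = restrict x τ<x in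
          (y , y<x) , λ e → trans (cong lvl e) eq }
      }

    onLevel-unique : ∀ {α x} → TreeLevel κ _<T_ α x → lvl x ≡ α
    onLevel-unique {x = x} = HasOtp-unique (onLevel x)

    <T-isκTree : IsκTree κ _<T_
    <T-isκTree = record
      { isTree = <T-isTree
      ; level-inhab = λ α → let x , eq , _ = node α α ≤-refl in
          x , subst (λ γ → TreeLevel κ _<T_ γ x) eq (onLevel x)
      ; level-cover = λ x → lvl x , onLevel x
      ; level-size = λ α → let open Trace α in proj₁ few , record
          { to = λ { (x , _) → code (traceOf (rep x)) , proj₂ few (rep x) }
          ; cong = cong (λ x → code (traceOf (rep x)))
          ; injective = λ { {x , p} {y , q} eq → injective x y (onLevel-unique p) (onLevel-unique q) eq }
          }
      }
      where
      injective : ∀ {α} x y → lvl x ≡ α → lvl y ≡ α →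
        code (Trace.traceOf α (rep x)) ≡ code (Trace.traceOf α (rep y)) → x ≡ y
      injective x y refl eq e = Node-≡ (sym eq) (Trace.traceOf-Agree (lvl x) (lvl≤rep x)
        (subst (_≤ rep y) eq (lvl≤rep y)) (code-injective e))

    -- Specialness and the absence of cofinal branches

    G : Node → List Ord
    G x = ρ (lvl x) (rep x)

    G-walk : ∀ x → Walk (lvl x) (rep x) (G x)
    G-walk x = ρ-walk (lvl≤rep x)

    -- Agreement lets the value at `lvl x` be computed by a walk from `rep y`, and `walk-distinct`
    -- compares two walks from the same ordinal.
    G-distinct : ∀ {x y} → x <T y → ¬ G x ≡ G y
    G-distinct {x} {y} (x<y , agree) eq = walk-distinct x<y
      (subst (Walk (lvl x) (rep y)) (sym (agree _ ≤-refl)) (ρ-walk (≤-trans (inj₁ x<y) (lvl≤rep y))))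
      (G-walk y) eq

    G-bounded : ∀ x → D (lvl x) → All (_< lvl x) (G x)
    G-bounded x Dx = walk-bounded Dx (G-walk x)

    -- The regressive function restricts x to some level τ with Target x τ. That
    -- level bounds key x, and comparable nodes have distinct keys.
    Target : Node → Pred Ord ℓ
    Target x τ = (D (lvl x) × All (_< s τ) (G x)) ⊎
                 (¬ D (lvl x) × (∀ δ → D δ → δ ≤ lvl x → δ ≤ τ))

    target : ∀ x → o0 < lvl x → ∃[ τ ] τ < lvl x × Target x τ
    target x 0<x with dec (D (lvl x))
    ... | yes Dx = let τ , τ<x , p = All-<-limit 0<x (G-bounded x Dx) in τ , τ<x , inj₁ (Dx , p)
    -- As `D` is closed, its points below a level outside `D` are bounded below that level; such a
    -- bound is the required τ.
    ... | no ¬Dx = dne λ none → ¬Dx (D-closed _ (LimitPoint⁺ 0<x λ η η<x → dne λ none′ →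
      none (η , η<x , inj₂ (¬Dx , λ δ Dδ δ≤x → ≮⇒≥ λ η<δ → none′ (δ , Dδ , η<δ , strict Dδ δ≤x)))))
      where
      strict : ∀ {δ} → D δ → δ ≤ lvl x → δ < lvl x
      strict Dδ (inj₁ p)    = p
      strict Dδ (inj₂ refl) = contradiction Dδ ¬Dx

    regress : ∀ x → Dec (∃[ τ ] τ < lvl x × Target x τ) → Node
    regress x (yes (_ , τ<x , _)) = proj₁ (restrict x τ<x)
    regress x (no _)              = x

    -- The leading entry separates levels in `D` from the others. Off `D` the level itself tells
    -- comparable nodes apart.
    key : ∀ x → Dec (D (lvl x)) → List Ord
    key x (yes _) = o0 ∷ G x
    key x (no _)  = s o0 ∷ lvl x ∷ []

    key-distinct : ∀ {x y} dx dy → x <T y → ¬ key x dx ≡ key y dy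
    key-distinct (yes _) (yes _) p eq = G-distinct p (proj₂ (∷-injective eq))
    key-distinct (yes _) (no _)  p eq = 0≢s (proj₁ (∷-injective eq))
    key-distinct (no _)  (yes _) p eq = 0≢s (sym (proj₁ (∷-injective eq)))
    key-distinct {x} {y} (no _) (no _) p eq = <-irrefl
      (subst (_< lvl y) (proj₁ (∷-injective (proj₂ (∷-injective eq)))) (lvl-< p))

    -- For a node off `D` that is restricted to τ, no point of `D` lies above τ and at or below its
    -- level, so a point of `D` above τ bounds the level. The part `s (s τ)` covers the leading
    -- entries and the lists bounded by `s τ`.
    key-bound : Ord → Ord
    key-bound τ = proj₁ (D-unbounded τ) ∨ s (s τ)

    key-bounded : ∀ x d d′ → All (_< key-bound (lvl (regress x d))) (key x d′)
    key-bounded x d d′ = go d d′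
      where
      s0< : ∀ τ → s o0 < key-bound τ
      s0< τ = <-≤-trans (≤⇒<s (s-mono-≤ (o0≤ τ))) (≤-∨ʳ (proj₁ (D-unbounded τ)) _)
      go : ∀ d d′ → All (_< key-bound (lvl (regress x d))) (key x d′)
      go (no none) (yes Dx) = contradiction (target x (D>0 Dx)) none
      go (no none) (no _) with ≮⇒≥ (λ 0<x → none (target x 0<x))
      ... | inj₁ x<0 = contradiction x<0 (≤⇒≯ (o0≤ _))
      ... | inj₂ eq  = s0< (lvl x) ∷ subst (_< key-bound (lvl x)) (sym eq) (<-trans (<s o0) (s0< (lvl x))) ∷ []
      go (yes (τ , τ<x , t)) d′ with restrict x τ<x | t | d′
      ... | y , refl , _ | inj₁ (_ , ps) | yes _ = <-trans (<s o0) (s0< τ) ∷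
              All-<-mono (≤-trans (inj₁ (<s (s τ))) (≤-∨ʳ (proj₁ (D-unbounded τ)) _)) ps
      ... | y , refl , _ | inj₁ (Dx , _)   | no ¬Dx = contradiction Dx ¬Dx
      ... | y , refl , _ | inj₂ (¬Dx , _)  | yes Dx = contradiction Dx ¬Dx
      ... | y , refl , _ | inj₂ (_ , gap)  | no _   = s0< τ ∷ <-≤-trans beyond (≤-∨ˡ _ (s (s τ))) ∷ []
        where
        beyond : lvl x < proj₁ (D-unbounded τ)
        beyond = ≰⇒> λ p → let _ , Dδ , τ<δ = D-unbounded τ in ≤⇒≯ (gap _ Dδ p) τ<δ

    <T-isSpecial : IsSpecial κ _<T_
    <T-isSpecial = (λ x → regress x (dec _)) , (λ { x (y , (y<x , _)) → regress-< x (>0 y<x) (dec _) })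
      , λ z → let β , bound = small-lists (key-bound (lvl z)) code in
          -- The antichains over `z` are the level sets of the coded key.
          β , (λ η x → code (key x (dec _)) ≡ η)
        , (λ η _ x y p q x<y → key-distinct (dec _) (dec _) x<y (code-injective (trans p (sym q))))
        , λ { x refl → _ , bound _ (key-bounded x (dec _) (dec _)) , refl }
      where
      regress-< : ∀ x → o0 < lvl x → ∀ d → regress x d <T x
      regress-< x 0<x (yes (_ , τ<x , _)) = proj₂ (proj₂ (restrict x τ<x))
      regress-< x 0<x (no none)           = contradiction (target x 0<x) none

    -- A chain of size κ gives pairwise distinct lists `b δ`, so `h γ` can bound all δ whose list
    -- has entries at most γ. If δ ∈ `D` is closed under `h`, the entries of `b δ` are at most some
    -- γ < δ, whence δ < `h γ` < δ.
    no-branch : ∀ B → IsChain κ _<T_ B → ¬ Bijection ⟨ B ⟩ (setoid Ord)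
    no-branch B chain bij =
      let δ , _ , lp , clo = closurePoint D-unbounded h o0
          Dδ = D-closed δ lp
          γ , γ<δ , p = All-<-limit (D>0 Dδ) (walk-bounded Dδ (b-walk δ))
      in ≤⇒≯ (inj₁ (clo γ γ<δ)) (proj₂ (small-b (s γ) (λ δ → δ)) δ p)
      where
      module Bij = Bijection bij
      module Chain = IsStrictTotalOrder chain

      value : Node → Ord
      value x with dec (B x)
      ... | yes Bx = Bij.to (x , Bx)
      ... | no _   = o0

      value-to : ∀ x Bx → value x ≡ Bij.to (x , Bx)
      value-to x Bx with dec (B x)
      ... | yes _  = Bij.cong refl
      ... | no ¬Bx = contradiction Bx ¬Bx

      lvl-injective : ∀ x y → B x → B y → lvl x ≡ lvl y → x ≡ y
      lvl-injective x y Bx By eq with Chain.compare (x , Bx) (y , By)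
      ... | tri< (p , _) _ _ = contradiction (subst (_< lvl y) eq p) <-irrefl
      ... | tri≈ _ p _       = p
      ... | tri> _ _ (p , _) = contradiction (subst (lvl y <_) eq p) <-irrefl

      opaque
        -- Levels are injective on a chain. Were they bounded, the chain would be small and could
        -- not be mapped onto κ.
        B-unbounded : ∀ α → ∃[ x ] B x × α < lvl x
        B-unbounded α = dne λ none →
          let β , bound = small-inj lvl (λ x Bx → ≤⇒<s (≮⇒≥ λ α<x → none (x , Bx , α<x)))
                            lvl-injective (small-↓ (s α)) value
              (x , Bx) , eq = Bij.surjective β
          in <-irrefl (subst (_< β) (trans (value-to x Bx) (eq refl)) (bound x Bx))

      branch : Ord → Node
      branch δ = proj₁ (B-unbounded δ)

      branch-> : ∀ δ → δ < lvl (branch δ)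
      branch-> δ = proj₂ (proj₂ (B-unbounded δ))

      b : Ord → List Ord
      b δ = ρ δ (rep (branch δ))

      b-walk : ∀ δ → Walk δ (rep (branch δ)) (b δ)
      b-walk δ = ρ-walk (≤-trans (inj₁ (branch-> δ)) (lvl≤rep (branch δ)))

      b-coherent : ∀ {δ δ′} → δ < δ′ → b δ ≡ ρ δ (rep (branch δ′))
      b-coherent {δ} {δ′} δ<δ′ with Chain.compare (_ , proj₁ (proj₂ (B-unbounded δ))) (_ , proj₁ (proj₂ (B-unbounded δ′)))
      ... | tri< (_ , agree) _ _ = agree δ (inj₁ (branch-> δ))
      ... | tri≈ _ p _           = cong (λ x → ρ δ (rep x)) p
      ... | tri> _ _ (_ , agree) = sym (agree δ (inj₁ (<-trans δ<δ′ (branch-> δ′))))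

      b-distinct : ∀ {δ δ′} → δ < δ′ → ¬ b δ ≡ b δ′
      b-distinct {δ} {δ′} δ<δ′ = walk-distinct δ<δ′
        (subst (Walk δ (rep (branch δ′))) (sym (b-coherent δ<δ′))
          (ρ-walk (≤-trans (inj₁ (<-trans δ<δ′ (branch-> δ′))) (lvl≤rep (branch δ′)))))
        (b-walk δ′)

      b-injective : ∀ δ δ′ → b δ ≡ b δ′ → δ ≡ δ′
      b-injective δ δ′ eq with compare δ δ′
      ... | tri< p _ _ = contradiction eq (b-distinct p)
      ... | tri≈ _ p _ = p
      ... | tri> _ _ p = contradiction (sym eq) (b-distinct p)

      small-b : ∀ γ → Small (λ δ → All (_< γ) (b δ))
      small-b γ = small-inj b (λ _ p → p) (λ δ δ′ _ _ → b-injective δ δ′) (small-lists γ)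

      h : Ord → Ord
      h γ = proj₁ (small-b (s γ) (λ δ → δ))

    specialTree : SpecialκAronszajnTree κ
    specialTree = Node , _<T_ , record { isκTree = <T-isκTree ; no-chain = no-branch } , <T-isSpecial

  -- Indices identified by the setoid may have different codes, so each index is sent to the least
  -- code occurring in its class.
  few⇒Size<κ : ∀ {i t e} {I : Set i} (S : Setoid t e) (f : I → Setoid.Carrier S) (c : I → Ord) {β : Ord} →
    (∀ i → c i < β) → (∀ {i j} → c i ≡ c j → Setoid._≈_ S (f i) (f j)) → Size<κ κ (image S f)
  few⇒Size<κ {I = I} S f c {β} c<β determined = β , record
    { to = λ i → proj₁ (value i) , ≤-<-trans (proj₂ (proj₂ (value i)) (c i) (i , S.refl , refl)) (c<β i)
    ; cong = λ {i} {j} i~j → ≤-antisym (value-≤ i~j) (value-≤ (S.sym i~j))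
    ; injective = λ {i} {j} → injective {i} {j}
    }
    where
    module S = Setoid S
    Attains : I → Pred Ord _
    Attains i v = ∃[ j ] f j S.≈ f i × c j ≡ v
    value : ∀ i → ∃ (Least (Attains i))
    value i = least (Attains i) (c i , i , S.refl , refl)
    value-≤ : ∀ {i j} → f i S.≈ f j → proj₁ (value i) ≤ proj₁ (value j)
    value-≤ {i} {j} i~j =
      let k , k~j , eq = proj₁ (proj₂ (value j))
      in proj₂ (proj₂ (value i)) _ (k , S.trans k~j (S.sym i~j) , eq)
    injective : ∀ {i j} → proj₁ (value i) ≡ proj₁ (value j) → f i S.≈ f j
    injective {i} {j} eq =
      let k , k~i , p = proj₁ (proj₂ (value i))
          l , l~j , q = proj₁ (proj₂ (value j))
      in S.trans (S.sym k~i) (S.trans (determined (trans p (trans eq (sym q)))) l~j)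

  Sup<⁺ : ∀ {p} {A : Pred Ord p} {δ} → (∀ ξ → A ξ → ξ < δ) → o0 < δ → ¬ LimitPoint κ A δ → Sup< κ A δ
  Sup<⁺ {A = A} {δ} A<δ 0<δ ¬lp =
    let η , η<δ , ub = bound
        σ , σ-sup , σ≤η = isSup ub
    in σ , σ-sup , ≤-<-trans σ≤η η<δ
    where
    bound : ∃[ η ] η < δ × (∀ ξ → A ξ → ξ ≤ η)
    bound = dne λ none → ¬lp (LimitPoint⁺ 0<δ λ η η<δ → dne λ none′ →
      none (η , η<δ , λ ξ Aξ → ≮⇒≥ λ η<ξ → none′ (ξ , Aξ , η<ξ , A<δ ξ Aξ)))

  -- From special trees to square sequences

  module TreeToSquare {T : Set ℓ} {_≺_ : Rel T ℓ} (κTree : IsκTree κ _≺_) (special : IsSpecial κ _≺_) where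
    open IsκTree κTree
    open IsTree isTree

    -- Heights and predecessors in the tree

    ≺-trans : ∀ {x y z} → x ≺ y → y ≺ z → x ≺ z
    ≺-trans = IsStrictPartialOrder.trans isStrictPartialOrder

    ht : T → Ord
    ht x = proj₁ (level-cover x)

    onLevel : ∀ x → TreeLevel κ _≺_ (ht x) x
    onLevel x = proj₂ (level-cover x)

    module _ (x : T) where
      private
        f = proj₁ (onLevel x)
        module Iso = IsOrderIsomorphism (proj₂ (onLevel x))

      -- The isomorphism below `x` restricts to one below `y`, and order types are unique.
      ht-below : ∀ {y} (y≺x : y ≺ x) → ht y ≡ proj₁ (f (y , y≺x))
      ht-below {y} y≺x = HasOtp-unique (onLevel y) ((λ { (z , z≺y) → proj₁ (f (z , ≺-trans z≺y y≺x)) , Iso.mono z≺y }) , record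
        { isOrderMonomorphism = record
          { isOrderHomomorphism = record { cong = Iso.cong ; mono = Iso.mono }
          ; injective = Iso.injective
          ; cancel = Iso.cancel
          }
        ; surjective = λ { (η , η<y) →
            let (z , z≺x) , eq = Iso.surjective (η , <-trans η<y (proj₂ (f (y , y≺x))))
                z≺y = Iso.cancel {z , z≺x} {y , y≺x} (subst (_< proj₁ (f (y , y≺x))) (sym (eq refl)) η<y)
            in (z , z≺y) , λ { {_ , z′≺y} e → trans (Iso.cong {_ , ≺-trans z′≺y y≺x} {z , z≺x} e) (eq refl) } }
        })

      ht-< : ∀ {y} → y ≺ x → ht y < ht x
      ht-< y≺x = subst (_< ht x) (sym (ht-below y≺x)) (proj₂ (f (_ , y≺x)))

      below-exists : ∀ {γ} → γ < ht x → ∃[ y ] y ≺ x × ht y ≡ γ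
      below-exists {γ} γ<x =
        let (y , y≺x) , eq = Iso.surjective (γ , γ<x) in y , y≺x , trans (ht-below y≺x) (eq refl)

      below-unique : ∀ {y z} → y ≺ x → z ≺ x → ht y ≡ ht z → y ≡ z
      below-unique p q eq = Iso.injective {_ , p} {_ , q} (trans (sym (ht-below p)) (trans eq (ht-below q)))

      below-≺ : ∀ {y z} → y ≺ x → z ≺ x → ht y < ht z → y ≺ z
      below-≺ p q lt = Iso.cancel {_ , p} {_ , q} (subst₂ _<_ (ht-below p) (ht-below q) lt)

    module LevelSize α = Injection (proj₂ (level-size α))

    idx : T → Ord
    idx x = proj₁ (LevelSize.to (ht x) (x , onLevel x))

    idx-injective : ∀ {x y} → ht x ≡ ht y → idx x ≡ idx y → x ≡ y
    idx-injective {x} {y} = go (onLevel x) (onLevel y)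
      where
      go : ∀ {α β} (p : TreeLevel κ _≺_ α x) (q : TreeLevel κ _≺_ β y) → α ≡ β →
        proj₁ (LevelSize.to α (x , p)) ≡ proj₁ (LevelSize.to β (y , q)) → x ≡ y
      go {α} p q refl = LevelSize.injective α

    small-level : ∀ γ → Small (λ x → ht x ≡ γ)
    small-level γ = small-inj idx (λ { x refl → proj₂ (LevelSize.to (ht x) (x , onLevel x)) })
      (λ { x y p q → idx-injective (trans p (sym q)) }) (small-↓ (proj₁ (level-size γ)))

    e : T → Ord
    e x = pair (ht x) (idx x)

    e-injective : ∀ {x y} → e x ≡ e y → x ≡ y
    e-injective eq = let p , q = pair-injective eq in idx-injective p q

    -- A function into κ that is injective on chains

    f : T → T
    f = proj₁ special

    f-≺ : ∀ {x y} → y ≺ x → f x ≺ x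
    f-≺ y≺x = proj₁ (proj₂ special) _ (_ , y≺x)

    width : T → Ord
    width z = proj₁ (proj₂ (proj₂ special) z)

    piece : T → Ord → Pred T ℓ
    piece z = proj₁ (proj₂ (proj₂ (proj₂ special) z))

    piece-antichain : ∀ z η → η < width z → IsAntichain κ _≺_ (piece z η)
    piece-antichain z = proj₁ (proj₂ (proj₂ (proj₂ (proj₂ special) z)))

    inPiece : ∀ x → ∃[ η ] η < width (f x) × piece (f x) η x
    inPiece x = proj₂ (proj₂ (proj₂ (proj₂ (proj₂ special) (f x)))) x refl

    F : T → Ord
    F x = pair (e (f x)) (proj₁ (inPiece x))

    -- Nodes with equal values have the same image under `f` and lie in the same antichain over it.
    F-distinct : ∀ {x y} → y ≺ x → ¬ F y ≡ F x
    F-distinct {x} {y} y≺x eq =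
      let p , q = pair-injective eq
          η , η<w , x∈ = inPiece x
      in piece-antichain (f x) η η<w y x
           (subst₂ (λ z η → piece z η y) (e-injective p) q (proj₂ (proj₂ (inPiece y)))) x∈ y≺x

    K : T → Ord → Ord
    K x ν = s (pair (e x) ν)

    K-injective : ∀ {x y ν ν′} → K x ν ≡ K y ν′ → x ≡ y × ν ≡ ν′
    K-injective eq = let p , q = pair-injective (s-injective eq) in e-injective p , q

    ht<K : ∀ x ν → ht x < K x ν
    ht<K x ν = ≤⇒<s (≤-trans (≤-pair (ht x) (idx x)) (≤-pair (e x) ν))

    -- Closure points

    Value : Ord → Pred Ord ℓ
    Value γ ζ = (∃[ z ] ht z ≡ γ × ∃[ η ] η < width z × pair (e z) η ≡ ζ) ⊎
                (∃[ z ] ht z ≡ γ × ∃[ ν ] ν < γ × K z ν ≡ ζ)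

    opaque
      small-Value : ∀ γ → Small (Value γ)
      small-Value γ = small-∪
        (small-bind (small-level γ) λ z _ → small-image (pair (e z)) (small-↓ (width z)))
        (small-bind (small-level γ) λ z _ → small-image (K z) (small-↓ γ))

    -- A strict bound for every `F x` with `f x` at height γ, and for every code `K z ν` with `z` at
    -- height γ and ν < γ. Closure under `Φ` therefore makes `F` regressive and keeps codes below
    -- the points of `E`.
    Φ : Ord → Ord
    Φ γ = proj₁ (small-Value γ (λ ζ → ζ))

    ω : Ord
    ω = proj₁ (ω-sup nth (λ n → <s (nth n)))

    nth<ω : ∀ n → nth n < ω
    nth<ω = proj₁ (proj₂ (ω-sup nth (λ n → <s (nth n))))

    -- The condition `ω < δ` leaves room for the order type of a ladder.
    E E′ : Pred Ord ℓ
    E δ = ω < δ × (∀ γ → γ < δ → Φ γ < δ)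
    E′ = LimitPoint κ E

    E-closed : ∀ {δ} → E′ δ → E δ
    E-closed lp =
      (let _ , (ω<ξ , _) , _ , ξ<δ = LimitPoint⁻ lp o0 (LimitPoint>0 lp) in <-trans ω<ξ ξ<δ)
      , λ γ γ<δ → let _ , (_ , clo) , γ<ξ , ξ<δ = LimitPoint⁻ lp γ γ<δ in <-trans (clo γ γ<ξ) ξ<δ

    opaque
      E-unbounded : ∀ α → ∃[ β ] E β × α < β
      E-unbounded α =
        let β , m<β , _ , clo = closurePoint {D = λ _ → ⊤} (λ γ → s γ , tt , <s γ) Φ (ω ∨ α)
        in β , (≤-<-trans (≤-∨ˡ ω α) m<β , clo) , ≤-<-trans (≤-∨ʳ ω α) m<β

    E′-isClub : IsClub κ E′
    E′-isClub = record
      { closed = λ _ → LimitPoint-idem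
      ; unbounded = λ α → let β , α<β , lp , _ = closurePoint E-unbounded (λ γ → γ) α in β , lp , α<β
      }

    E>0 : ∀ {δ} → E δ → o0 < δ
    E>0 (ω<δ , _) = >0 ω<δ

    E′-s : ∀ {δ γ} → E′ δ → γ < δ → s γ < δ
    E′-s lp γ<δ = let _ , _ , γ<ξ , ξ<δ = LimitPoint⁻ lp _ γ<δ in ≤-<-trans (s≤ γ<ξ) ξ<δ

    F-< : ∀ x → E (ht x) → F x < ht x
    F-< x Ex =
      let _ , y≺x , _ = below-exists x (E>0 Ex)
          η , η<w , _ = inPiece x
      in <-trans (proj₂ (small-Value (ht (f x)) (λ ζ → ζ)) (F x) (inj₁ (f x , refl , η , η<w , refl)))
                 (proj₂ Ex _ (ht-< x (f-≺ y≺x)))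

    K-< : ∀ x {ν δ} → E δ → ht x < δ → ν < ht x → K x ν < δ
    K-< x {ν} Eδ x<δ ν<x = <-trans
      (proj₂ (small-Value (ht x) (λ ζ → ζ)) (K x ν) (inj₂ (x , refl , ν , ν<x , refl)))
      (proj₂ Eδ _ x<δ)

    -- Branches below the chosen nodes

    top : Ord → T
    top α = proj₁ (level-inhab α)

    ht-top : ∀ α → ht (top α) ≡ α
    ht-top α = HasOtp-unique (onLevel (top α)) (proj₂ (level-inhab α))

    opaque
      branch : ∀ α γ → ∃[ x ] (γ < α → x ≺ top α × ht x ≡ γ)
      branch α γ with dec (γ < α)
      ... | yes γ<α = let x , p = below-exists (top α) (subst (γ <_) (sym (ht-top α)) γ<α) in x , λ _ → p
      ... | no γ≮α  = top α , λ γ<α → contradiction γ<α γ≮α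

    -- Junk unless γ < α
    b : Ord → Ord → T
    b α γ = proj₁ (branch α γ)

    b-top : ∀ {α γ} → γ < α → b α γ ≺ top α
    b-top γ<α = proj₁ (proj₂ (branch _ _) γ<α)

    ht-b : ∀ {α γ} → γ < α → ht (b α γ) ≡ γ
    ht-b γ<α = proj₂ (proj₂ (branch _ _) γ<α)

    b-≺ : ∀ {α γ γ′} → γ < γ′ → γ′ < α → b α γ ≺ b α γ′
    b-≺ γ<γ′ γ′<α = let γ<α = <-trans γ<γ′ γ′<α in
      below-≺ _ (b-top γ<α) (b-top γ′<α) (subst₂ _<_ (sym (ht-b γ<α)) (sym (ht-b γ′<α)) γ<γ′)

    b-determined : ∀ {α α′ γ ε} → ε < α → ε < α′ → b α ε ≡ b α′ ε → γ < ε → b α γ ≡ b α′ γ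
    b-determined {α} {α′} ε<α ε<α′ eq γ<ε = below-unique _ (b-≺ γ<ε ε<α)
      (subst (b α′ _ ≺_) (sym eq) (b-≺ γ<ε ε<α′))
      (trans (ht-b (<-trans γ<ε ε<α)) (sym (ht-b (<-trans γ<ε ε<α′))))

    G : Ord → Ord → Ord
    G α γ = F (b α γ)

    G-distinct : ∀ {α γ γ′} → γ < γ′ → γ′ < α → ¬ G α γ ≡ G α γ′
    G-distinct p q = F-distinct (b-≺ p q)

    G-< : ∀ {α γ} → E γ → γ < α → G α γ < γ
    G-< {α} {γ} Eγ γ<α = subst (G α γ <_) (ht-b γ<α) (F-< (b α γ) (subst E (sym (ht-b γ<α)) Eγ))

    γ<Kb : ∀ {α γ ν} → γ < α → γ < K (b α γ) ν
    γ<Kb {α} {γ} {ν} γ<α = subst (_< K (b α γ) ν) (ht-b γ<α) (ht<K (b α γ) ν)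

    Kb-< : ∀ {α γ ν δ} → E δ → γ < δ → γ < α → ν < γ → K (b α γ) ν < δ
    Kb-< {α} {γ} {ν} {δ} Eδ γ<δ γ<α ν<γ =
      K-< (b α γ) Eδ (subst (_< δ) (sym (ht-b γ<α)) γ<δ) (subst (ν <_) (sym (ht-b γ<α)) ν<γ)

    -- Ladders and pressing down

    Low : Ord → Pred Ord ℓ
    Low α ν = ∀ η → η < α → ∃[ γ ] E γ × η < γ × γ < α × G α γ < ν

    record Ladder (α : Ord) : Set ℓ where
      field
        rung         : ℕ → Ord
        rung-E       : ∀ n → E (rung n)
        rung-step    : ∀ n → rung n < rung (suc n)
        rung-<       : ∀ n → rung n < α
        rung-cofinal : ∀ η → η < α → ∃[ n ] η < rung n

    -- Pressing down: if the values of G α on E ∩ α tended to α, a limit of ω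
    -- points of E ∩ α closed under the rate of growth would lie below α, and G α
    -- is regressive there.
    opaque
      low-exists : ∀ {α} → E′ α → ¬ Ladder α → ∃[ ν ] ν < α × Low α ν
      low-exists {α} E′α ¬ladder = dne λ none →
        let x , _ , xQ , xS = dependentChoice {Q = Q} {S = S} start (step none) in conclude x xQ xS
        where
        Q : Pred Ord ℓ
        Q x = E x × x < α
        S : Rel Ord ℓ
        S x y = x < y × (∀ γ → E γ → y < γ → γ < α → x ≤ G α γ)
        above : ∀ η → η < α → ∃[ y ] Q y × η < y
        above η η<α = let y , Ey , η<y , y<α = LimitPoint⁻ E′α η η<α in y , (Ey , y<α) , η<y
        start : ∃ Q
        start = let y , Qy , _ = above o0 (LimitPoint>0 E′α) in y , Qy
        conclude : (x : ℕ → Ord) → (∀ n → Q (x n)) → ¬ (∀ n → S (x n) (x (suc n)))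
        conclude x xQ xS with ω-sup x (proj₁ ∘ xS)
        ... | β , x<β , cofinal with dec (β < α)
        ...   | no β≮α = ¬ladder (record
                { rung = x ; rung-E = proj₁ ∘ xQ ; rung-step = proj₁ ∘ xS ; rung-< = proj₂ ∘ xQ
                ; rung-cofinal = λ η η<α → cofinal η (<-≤-trans η<α (≮⇒≥ β≮α)) })
        ...   | yes β<α = let n , G<xn = cofinal _ (G-< Eβ β<α) in
                ≤⇒≯ (proj₂ (xS n) β Eβ (x<β (suc n)) β<α) G<xn
          where
          Eβ : E β
          Eβ = E-closed (LimitPoint⁺ (>0 (x<β 0)) λ η η<β →
            let n , η<xn = cofinal η η<β in x n , proj₁ (xQ n) , η<xn , x<β n)
        step : ¬ (∃[ ν ] ν < α × Low α ν) → ∀ x → Q x → ∃[ y ] Q y × S x y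
        step none x (_ , x<α) =
          let η , η<α , high = rate
              y , Qy , m<y = above (x ∨ η) (∨-< x<α η<α)
          in y , Qy , ≤-<-trans (≤-∨ˡ x η) m<y
           , λ γ Eγ y<γ γ<α → high γ Eγ (<-trans (≤-<-trans (≤-∨ʳ x η) m<y) y<γ) γ<α
          where
          rate : ∃[ η ] η < α × (∀ γ → E γ → η < γ → γ < α → x ≤ G α γ)
          rate = dne λ none′ → none (x , x<α , λ η η<α → dne λ none″ →
            none′ (η , η<α , λ γ Eγ η<γ γ<α → ≮⇒≥ λ G<x → none″ (γ , Eγ , η<γ , γ<α , G<x)))

    -- The points of C α are tagged with ν, the lower limit of G α on E ∩ α. If they
    -- accumulate at δ < α, then G α stays below some G α γ₁ < ν cofinally in δ, so
    -- the tag belonging to the branch below δ is smaller; this gives V′.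
    Record : Ord → Pred Ord ℓ
    Record α γ = E γ × γ < α × (∀ γ′ → E γ′ → γ < γ′ → γ′ < α → G α γ < G α γ′)

    N : Ord → Ord → Pred Ord ℓ
    N α ν β = ∃[ γ ] Record α γ × ν < γ × K (b α γ) ν ≡ β

    Climb : Ord → Pred Ord ℓ
    Climb α ν = ν < α × Least (Low α) ν

    -- The three kinds of members of the C-sequence

    data Kind (α : Ord) : Set ℓ where
      interval : ¬ E′ α → Kind α
      ladder   : E′ α → Ladder α → Kind α
      climb    : ∀ ν → E′ α → Climb α ν → Kind α

    kind : ∀ α → Kind α
    kind α with dec (E′ α) | dec (Ladder α)
    ... | no ¬E′α | _     = interval ¬E′α
    ... | yes E′α | yes l = ladder E′α l
    ... | yes E′α | no ¬l =
      let ν , ν<α , low = low-exists E′α ¬l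
          ν′ , l′ = least (Low α) (ν , low)
      in climb ν′ E′α (≤-<-trans (proj₂ l′ ν low) ν<α , l′)

    -- The kind is a separate argument so that properties can be proved by cases on it.
    C′ : ∀ α → Kind α → Pred Ord ℓ
    C′ α (interval _)  β = β < α × (∀ δ → E′ δ → δ < α → δ ≤ β)
    C′ α (ladder _ l)  β = ∃[ n ] Ladder.rung l n ≡ β
    C′ α (climb ν _ _) β = N α ν β ⊎ (β < α × LimitPoint κ (N α ν) β)

    C : Ord → Pred Ord ℓ
    C α = C′ α (kind α)

    module LadderProperties {α} (l : Ladder α) where
      open Ladder l

      rung-reflects : ∀ {m n} → rung m < rung n → m Nat.< n
      rung-reflects {m} {n} p with Nat.<-cmp m n
      ... | tri< q _ _    = q
      ... | tri≈ _ refl _ = contradiction p <-irrefl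
      ... | tri> _ _ q    = contradiction p (≤⇒≯ (inj₁ (increasing rung rung-step q)))

      rung-mono : ∀ {m n} → m Nat.≤ n → rung m ≤ rung n
      rung-mono m≤n with Nat.m≤n⇒m<n∨m≡n m≤n
      ... | inj₁ m<n  = inj₁ (increasing rung rung-step m<n)
      ... | inj₂ refl = ≤-refl

      -- By induction every rung would lie below a limit point β of rungs, yet the rungs are cofinal
      -- in α.
      discrete : ∀ {β} → β < α → ¬ LimitPoint κ (λ ξ → ∃[ n ] rung n ≡ ξ) β
      discrete {β} β<α lp = let n , β<xn = rung-cofinal β β<α in ≤⇒≯ (inj₁ (all< n)) β<xn
        where
        all< : ∀ n → rung n < β
        all< zero with LimitPoint⁻ lp o0 (LimitPoint>0 lp)
        ... | _ , (m , refl) , _ , xm<β = ≤-<-trans (rung-mono Nat.z≤n) xm<β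
        all< (suc n) with LimitPoint⁻ lp (rung n) (all< n)
        ... | _ , (m , refl) , xn<xm , xm<β = ≤-<-trans (rung-mono (rung-reflects xn<xm)) xm<β

    module ClimbProperties {α ν} (E′α : E′ α) (c : Climb α ν) where

      ν<α : ν < α
      ν<α = proj₁ c

      low : Low α ν
      low = proj₁ (proj₂ c)

      C-climb : Pred Ord ℓ
      C-climb = C′ α (climb ν E′α c)

      N-< : ∀ {β} → N α ν β → β < α
      N-< (γ , (_ , γ<α , _) , ν<γ , refl) = Kb-< (E-closed E′α) γ<α γ<α ν<γ

      C-< : ∀ {β} → C-climb β → β < α
      C-< (inj₁ n)         = N-< n
      C-< (inj₂ (β<α , _)) = β<α

      ν<N : ∀ {β} → N α ν β → ν < β
      ν<N (γ , (_ , γ<α , _) , ν<γ , refl) = <-trans ν<γ (γ<Kb γ<α)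

      ν<C : ∀ {β} → C-climb β → ν < β
      ν<C (inj₁ n) = ν<N n
      ν<C (inj₂ (_ , lp)) = let _ , n , _ , ξ<β = LimitPoint⁻ lp o0 (LimitPoint>0 lp) in <-trans (ν<N n) ξ<β

      -- Minimise `G α` on the part of `E ∩ α` above η. Injectivity of `G α` makes the minimum
      -- strict on the remaining tail.
      record-cofinal : ∀ η → η < α → ∃[ γ ] Record α γ × η < γ
      record-cofinal η η<α =
        let γ₀ , Eγ₀ , η<γ₀ , γ₀<α = LimitPoint⁻ E′α η η<α
            v , (γ , Eγ , η<γ , γ<α , G≡v) , v-least =
              least (λ v → ∃[ γ ] E γ × η < γ × γ < α × G α γ ≡ v) (_ , γ₀ , Eγ₀ , η<γ₀ , γ₀<α , refl)
        in γ , (Eγ , γ<α , λ γ′ Eγ′ γ<γ′ γ′<α → case v-least _ (γ′ , Eγ′ , <-trans η<γ γ<γ′ , γ′<α , refl) of λ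
             { (inj₁ p) → subst (_< _) (sym G≡v) p
             ; (inj₂ p) → contradiction (trans G≡v p) (G-distinct γ<γ′ γ′<α) }) , η<γ

      N-cofinal : ∀ η → η < α → ∃[ β ] N α ν β × η < β
      N-cofinal η η<α =
        let γ , r , m<γ = record-cofinal (η ∨ ν) (∨-< η<α ν<α)
        in _ , (γ , r , ≤-<-trans (≤-∨ʳ η ν) m<γ , refl)
         , <-trans (≤-<-trans (≤-∨ˡ η ν) m<γ) (γ<Kb (proj₁ (proj₂ r)))

      LimitPoint-N : ∀ {β} → LimitPoint κ C-climb β → LimitPoint κ (N α ν) β
      LimitPoint-N {β} lp = LimitPoint⁺ (LimitPoint>0 lp) between
        where
        between : ∀ η → η < β → ∃[ ξ ] N α ν ξ × η < ξ × ξ < β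
        between η η<β with LimitPoint⁻ lp η η<β
        ... | ξ , inj₁ n , η<ξ , ξ<β = ξ , n , η<ξ , ξ<β
        ... | ξ , inj₂ (_ , lpξ) , η<ξ , ξ<β =
          let ζ , n , η<ζ , ζ<ξ = LimitPoint⁻ lpξ η η<ξ in ζ , n , η<ζ , <-trans ζ<ξ ξ<β

      nacc⇒N : ∀ {β} → nacc κ C-climb β → N α ν β
      nacc⇒N (inj₁ n , _) = n
      nacc⇒N (p@(inj₂ (_ , lp)) , ¬acc) = contradiction (p , LimitPoint-⊆ (λ _ _ → inj₁) lp) ¬acc

      G<ν : ∀ {γ} → Record α γ → G α γ < ν
      G<ν (_ , γ<α , minimal) =
        let γ′ , Eγ′ , γ<γ′ , γ′<α , G<ν = low _ γ<α in <-trans (minimal γ′ Eγ′ γ<γ′ γ′<α) G<ν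

      -- If γ′ < γ, then closure of γ ∈ `E` puts the code at γ′ below γ, while the code at γ lies
      -- above γ. So codes are ordered as the points they come from.
      K-reflects : ∀ {γ γ′} → Record α γ → Record α γ′ → ν < γ′ → K (b α γ) ν < K (b α γ′) ν → γ < γ′
      K-reflects {γ} {γ′} (Eγ , γ<α , _) (_ , γ′<α , _) ν<γ′ lt with compare γ γ′
      ... | tri< p _ _    = p
      ... | tri≈ _ refl _ = contradiction lt <-irrefl
      ... | tri> _ _ p    = contradiction lt (≤⇒≯ (inj₁ (<-trans (Kb-< Eγ p γ′<α ν<γ′) (γ<Kb γ<α))))

      G-increasing : ∀ {γ γ′} → Record α γ → Record α γ′ → ν < γ′ → K (b α γ) ν < K (b α γ′) ν → G α γ < G α γ′
      G-increasing r@(_ , _ , minimal) r′@(Eγ′ , γ′<α , _) ν<γ′ lt =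
        minimal _ Eγ′ (K-reflects r r′ ν<γ′ lt) γ′<α

      upper : ∀ β → ∃ (Least (λ u → ∀ γ → Record α γ → K (b α γ) ν < β → G α γ < u))
      upper β = least _ (ν , λ γ r _ → G<ν r)

      -- An increasing map into ν + 1. The successor at a code makes room for a limit point before
      -- it, whose position can be as large as `G α γ`.
      position : ∀ β → C-climb β → Ord
      position β (inj₁ (γ , _)) = s (G α γ)
      position β (inj₂ _)       = proj₁ (upper β)

      position-< : ∀ {β} c → position β c < s ν
      position-< (inj₁ (γ , r , _)) = s-mono (G<ν r)
      position-< {β} (inj₂ _)       = ≤⇒<s (proj₂ (proj₂ (upper β)) ν λ γ r _ → G<ν r)

      position-mono : ∀ {β β′} c c′ → β < β′ → position β c < position β′ c′
      position-mono (inj₁ (γ , r , _ , refl)) (inj₁ (γ′ , r′ , ν<γ′ , refl)) lt =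
        s-mono (G-increasing r r′ ν<γ′ lt)
      position-mono {β′ = β′} (inj₁ (γ , r , _ , refl)) (inj₂ (_ , lp)) lt with LimitPoint⁻ lp _ lt
      ... | _ , (γ″ , r″ , ν<γ″ , refl) , lt₁ , lt₂ =
        ≤-<-trans (s≤ (G-increasing r r″ ν<γ″ lt₁)) (proj₁ (proj₂ (upper β′)) γ″ r″ lt₂)
      position-mono {β} (inj₂ _) (inj₁ (γ′ , r′ , ν<γ′ , refl)) lt =
        ≤⇒<s (proj₂ (proj₂ (upper β)) _ λ γ r lt′ → G-increasing r r′ ν<γ′ (<-trans lt′ lt))
      position-mono {β} {β′} (inj₂ _) (inj₂ (_ , lp)) lt with LimitPoint⁻ lp _ lt
      ... | _ , (γ″ , r″ , ν<γ″ , refl) , lt₁ , lt₂ = ≤-<-trans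
        (proj₂ (proj₂ (upper β)) _ λ γ r lt′ → G-increasing r r″ ν<γ″ (<-trans lt′ lt₁))
        (proj₁ (proj₂ (upper β′)) γ″ r″ lt₂)

    -- C-sequence axioms, order types and almost disjointness

    IsSup⁺ : ∀ {p} {A : Pred Ord p} {α} → (∀ ξ → A ξ → ξ < α) →
      (∀ η → η < α → ∃[ ξ ] A ξ × η < ξ) → IsSup κ A α
    IsSup⁺ A<α cofinal = (λ ξ Aξ → inj₁ (A<α ξ Aξ)) , λ τ ub → ≮⇒≥ λ τ<α →
      let ξ , Aξ , τ<ξ = cofinal τ τ<α in ≤⇒≯ (ub ξ Aξ) τ<ξ

    C′-< : ∀ {α} k {β} → C′ α k β → β < α
    C′-< (interval _)  (β<α , _)  = β<α
    C′-< (ladder _ l)  (n , refl) = Ladder.rung-< l n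
    C′-< (climb _ E′α c)          = ClimbProperties.C-< E′α c

    C′-closed : ∀ {α} k β → β < α → LimitPoint κ (C′ α k) β → C′ α k β
    C′-closed (interval _) β β<α lp = β<α , λ δ E′δ δ<α →
      let _ , (_ , above) , _ , ξ<β = LimitPoint⁻ lp o0 (LimitPoint>0 lp)
      in inj₁ (≤-<-trans (above δ E′δ δ<α) ξ<β)
    C′-closed (ladder _ l) β β<α lp = contradiction lp (LadderProperties.discrete l β<α)
    C′-closed (climb _ E′α c) β β<α lp = inj₂ (β<α , ClimbProperties.LimitPoint-N E′α c lp)

    C′-sup : ∀ {α} k → ∃[ σ ] IsSup κ (C′ α k) σ × IsSup κ (↓ α) σ
    C′-sup {α} (ladder E′α l) = α
      , IsSup⁺ (λ { _ (n , refl) → Ladder.rung-< l n })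
               (λ η η<α → let n , η<xn = Ladder.rung-cofinal l η η<α in _ , (n , refl) , η<xn)
      , proj₁ (LimitPoint⇒accκ E′α)
    C′-sup {α} (climb ν E′α c) = α
      , IsSup⁺ (λ _ → C-<) (λ η η<α → let β , n , η<β = N-cofinal η η<α in β , inj₁ n , η<β)
      , proj₁ (LimitPoint⇒accκ E′α)
      where open ClimbProperties E′α c
    C′-sup {α} (interval ¬E′α) with dec (∃[ η ] α ≡ s η)
    ... | yes (η , refl) = η
      , ((λ _ → <s⇒≤ ∘ proj₁) , λ τ ub → ub η (<s η , λ _ _ → <s⇒≤))
      , ((λ _ → <s⇒≤) , λ τ ub → ub η (<s η))
    -- This covers limits and also 0, where the cofinality conditions are vacuous.
    ... | no ¬succ = α
      , IsSup⁺ (λ _ → proj₁) (λ η η<α →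
          let ζ , ζ<α , gap = last η η<α
          in s (η ∨ ζ) , (limit (∨-< η<α ζ<α) , λ δ E′δ δ<α →
               ≤-trans (≮⇒≥ λ ζ<δ → gap δ E′δ ζ<δ δ<α) (inj₁ (≤-<-trans (≤-∨ʳ η ζ) (<s (η ∨ ζ)))))
             , ≤-<-trans (≤-∨ˡ η ζ) (<s (η ∨ ζ)))
      , IsSup⁺ (λ _ ξ<α → ξ<α) (λ η η<α → s η , limit η<α , <s η)
      where
      limit : ∀ {η} → η < α → s η < α
      limit {η} η<α with s≤ η<α
      ... | inj₁ p  = p
      ... | inj₂ eq = contradiction (η , sym eq) ¬succ
      -- Limits of `E` that were cofinal in α would make α itself a limit of `E`.
      last : ∀ η → η < α → ∃[ ζ ] ζ < α × (∀ δ → E′ δ → ζ < δ → ¬ δ < α)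
      last η η<α = dne λ none → ¬E′α (LimitPoint-idem (LimitPoint⁺ (>0 η<α) λ ζ ζ<α → dne λ none′ →
        none (ζ , ζ<α , λ δ E′δ ζ<δ δ<α → none′ (δ , E′δ , ζ<δ , δ<α))))

    C-isCSequence : IsCSequence κ C
    C-isCSequence = record
      { subset = λ α → C′-< (kind α)
      ; closed = λ α → C′-closed (kind α)
      ; sup-eq = λ α → C′-sup (kind α)
      }

    -- Below δ an interval has no points, a ladder has order type at most ω < δ, and a climb has
    -- order type at most ν + 1 if ν < δ and is empty otherwise. Taking `P` to be `C α ∩ ↓ δ` or
    -- `C δ` serves `R` and `R′` respectively.
    C′-otp : ∀ {p} {P : Pred Ord p} {α δ} k → E′ δ → δ ≤ α →
      (∀ {ξ} → P ξ → C′ α k ξ) → (∀ {ξ} → P ξ → ξ < δ) → Otp< κ P δ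
    C′-otp {P = P} {α} {δ} k E′δ δ≤α P⊆C P<δ = go k P⊆C
      where
      otp≤ : ∀ {θ} → θ < δ → ∃[ γ ] HasOtp κ _<_ P γ × γ ≤ θ → Otp< κ P δ
      otp≤ θ<δ (γ , otp , γ≤θ) = γ , otp , ≤-<-trans γ≤θ θ<δ
      empty : (∀ {ξ} → ¬ P ξ) → Otp< κ P δ
      empty none = otp≤ (LimitPoint>0 E′δ)
        (otp-bounded P (λ _ p → contradiction p none) (λ p → contradiction p none) (λ _ p → contradiction p none))
      go : ∀ k → (∀ {ξ} → P ξ → C′ α k ξ) → Otp< κ P δ
      go (interval ¬E′α) P⊆C = empty λ Pξ → ≤⇒≯ (proj₂ (P⊆C Pξ) δ E′δ (strict δ≤α)) (P<δ Pξ)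
        where
        strict : δ ≤ α → δ < α
        strict (inj₁ p)    = p
        strict (inj₂ refl) = contradiction E′δ ¬E′α
      go (ladder _ l) P⊆C = otp≤ (proj₁ (E-closed E′δ)) (otp-bounded P
        (λ _ p → nth (proj₁ (P⊆C p)))
        (λ p q lt → increasing nth (λ n → <s (nth n))
          (rung-reflects (subst₂ _<_ (sym (proj₂ (P⊆C p))) (sym (proj₂ (P⊆C q))) lt)))
        (λ _ p → nth<ω (proj₁ (P⊆C p))))
        where open LadderProperties l
      go (climb ν E′α c) P⊆C with dec (ν < δ)
      ... | yes ν<δ = otp≤ (E′-s E′δ ν<δ) (otp-bounded P (λ ξ p → position ξ (P⊆C p))
              (λ p q → position-mono (P⊆C p) (P⊆C q)) (λ _ p → position-< (P⊆C p)))
        where open ClimbProperties E′α c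
      ... | no ν≮δ = empty λ Pξ → ν≮δ (<-trans (ClimbProperties.ν<C E′α c (P⊆C Pξ)) (P<δ Pξ))

    E′⊆R : ∀ {δ} → E′ δ → R κ C δ
    E′⊆R E′δ = LimitPoint⇒accκ E′δ , λ α δ<α → C′-otp (kind α) E′δ (inj₁ δ<α) proj₁ proj₂

    E′⊆R′ : ∀ {δ} → E′ δ → R′ κ C δ
    E′⊆R′ {δ} E′δ = E′⊆R E′δ , C′-otp (kind δ) E′δ ≤-refl (λ p → p) (C′-< (kind δ))

    -- An interval misses δ, and a ladder has no limit point below α. A ladder and a climb share no
    -- non-accumulation point: rungs lie in `E`, whereas a point of `E` above γ also exceeds the
    -- code at γ. Two climbs are separated by the tag ν.
    nacc-almostDisjoint : ∀ {δ α} kδ kα → E′ δ → δ < α →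
      ¬ LimitPoint κ (nacc κ (C′ δ kδ) ∩ nacc κ (C′ α kα)) δ
    nacc-almostDisjoint _ (interval _) E′δ δ<α lp =
      let _ , (_ , (_ , above) , _) , _ , ξ<δ = LimitPoint⁻ lp o0 (LimitPoint>0 lp)
      in ≤⇒≯ (above _ E′δ δ<α) ξ<δ
    nacc-almostDisjoint _ (ladder _ l) E′δ δ<α lp =
      LadderProperties.discrete l δ<α (LimitPoint-⊆ (λ _ _ → proj₁ ∘ proj₂) lp)
    nacc-almostDisjoint (interval ¬E′δ) (climb _ _ _) E′δ _ _ = ¬E′δ E′δ
    nacc-almostDisjoint (ladder _ l) (climb ν E′α c) E′δ δ<α lp
      with LimitPoint⁻ lp o0 (LimitPoint>0 lp)
    ... | ξ , (((n , refl) , _) , nacc-α) , _ with ClimbProperties.nacc⇒N E′α c nacc-α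
    ...   | γ , (_ , γ<α , _) , ν<γ , eq = <-irrefl (subst (_< ξ) eq
              (Kb-< (Ladder.rung-E l n) (subst (γ <_) eq (γ<Kb γ<α)) γ<α ν<γ))
    nacc-almostDisjoint {δ} {α} (climb ν _ cδ) (climb ν′ E′α cα) E′δ δ<α lp =
      ≤⇒≯ (proj₂ (proj₂ cδ) _ low-δ) (subst (G α γ₁ <_) (sym (proj₂ (proj₂ (proj₂ (proj₂ (common o0 (LimitPoint>0 E′δ))))))) G₁<ν′)
      where
      module Cδ = ClimbProperties E′δ cδ
      module Cα = ClimbProperties E′α cα

      -- A shared code determines node and tag, so the branches meet at γ and ν = ν′. Choosing the
      -- code above some ε ∈ `E` with η < ε forces ε ≤ γ, since codes from heights below ε stay
      -- below ε.
      common : ∀ η → η < δ → ∃[ γ ] (η < γ × γ < δ) × Record α γ × b δ γ ≡ b α γ × ν ≡ ν′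
      common η η<δ with LimitPoint⁻ E′δ η η<δ
      ... | ε , Eε , η<ε , ε<δ with LimitPoint⁻ lp ε ε<δ
      ...   | ξ , (p , q) , ε<ξ , ξ<δ with Cδ.nacc⇒N p | Cα.nacc⇒N q
      ...     | γ , (_ , γ<δ , _) , ν<γ , refl | γ′ , r , _ , eq with K-injective eq
      ...       | b≡ , refl with trans (sym (ht-b (proj₁ (proj₂ r)))) (trans (cong ht b≡) (ht-b γ<δ))
      ...         | refl = γ
                    , (<-≤-trans η<ε (≮⇒≥ λ γ<ε → ≤⇒≯ (inj₁ (Kb-< Eε γ<ε γ<δ ν<γ)) ε<ξ) , γ<δ)
                    , r , sym b≡ , refl

      γ₁ = proj₁ (Cα.low δ δ<α)
      G₁<ν′ = proj₂ (proj₂ (proj₂ (proj₂ (Cα.low δ δ<α))))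

      low-δ : Low δ (G α γ₁)
      low-δ η η<δ =
        let γ , (η<γ , γ<δ) , (Eγ , _ , minimal) , b≡ , _ = common η η<δ
            _ , Eγ₁ , δ<γ₁ , γ₁<α , _ = Cα.low δ δ<α
        in γ , Eγ , η<γ , γ<δ
         , subst (_< G α γ₁) (cong F (sym b≡)) (minimal γ₁ Eγ₁ (<-trans γ<δ δ<γ₁) γ₁<α)

    E′⊆V′ : ∀ {δ} → E′ δ → V′ κ C δ
    E′⊆V′ {δ} E′δ = LimitPoint⇒accκ E′δ , λ α δ<α →
      Sup<⁺ (λ ξ p → C′-< (kind δ) (proj₁ (proj₁ p))) (LimitPoint>0 E′δ)
        (nacc-almostDisjoint (kind δ) (kind α) E′δ δ<α)

    -- Weak coherence

    module Coherence (ε : Ord) where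

      -- Points below ε cannot distinguish cut-offs at or above ε, so truncation loses nothing and
      -- leaves few values.
      cap : Ord → Ord
      cap η with dec (η < ε)
      ... | yes _ = η
      ... | no _  = ε

      cap-< : ∀ η → cap η < s ε
      cap-< η with dec (η < ε)
      ... | yes η<ε = <-trans η<ε (<s ε)
      ... | no _    = <s ε

      cap-reflects : ∀ {η η′ β} → cap η ≡ cap η′ → β < ε → η ≤ β → η′ ≤ β
      cap-reflects {η} {η′} eq β<ε η≤β with dec (η < ε) | dec (η′ < ε)
      ... | yes _   | yes _ = subst (_≤ _) eq η≤β
      ... | yes η<ε | no _  = contradiction (subst (_< ε) eq η<ε) <-irrefl
      ... | no η≮ε  | _     = contradiction (≤-<-trans η≤β β<ε) η≮ε

      gap : ∀ α → ∃ (Least (λ η → ∀ δ → E′ δ → δ < α → δ ≤ η))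
      gap α = least _ (α , λ _ _ → inj₁)

      -- This minimum decides which strict minima of the part below ε survive on the whole tail. It
      -- can be capped at ε, because `G α` takes values below ε on `E ∩ ε`.
      minG : ∀ {α} → E′ α → ε < α → ∃ (Least (λ v → ∃[ γ ] E γ × ε ≤ γ × γ < α × G α γ ≡ v))
      minG E′α ε<α = let γ , Eγ , ε<γ , γ<α = LimitPoint⁻ E′α ε ε<α in
        least _ (_ , γ , Eγ , inj₁ ε<γ , γ<α , refl)

      module _ {α} (l : Ladder α) where
        open Ladder l

        rungs : ∀ n → ∃[ L ] All (_< ε) L × (∀ {β} → β ∈ˡ L → ∃[ m ] rung m ≡ β) ×
                             (∀ {m} → m Nat.< n → rung m < ε → rung m ∈ˡ L)
        rungs zero = [] , [] , (λ ()) , λ ()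
        rungs (suc n) with rungs n | dec (rung n < ε)
        ... | L , bounded , sound , complete | yes p =
          rung n ∷ L , p ∷ bounded , (λ { (here refl) → n , refl ; (there q) → sound q })
          , λ { (Nat.s≤s m≤n) q → case Nat.m≤n⇒m<n∨m≡n m≤n of λ
                { (inj₁ m<n) → there (complete m<n q) ; (inj₂ refl) → here refl } }
        ... | L , bounded , sound , complete | no ¬p =
          L , bounded , sound
          , λ { (Nat.s≤s m≤n) q → case Nat.m≤n⇒m<n∨m≡n m≤n of λ
                { (inj₁ m<n) → complete m<n q ; (inj₂ refl) → contradiction q ¬p } }

        rungsBelow : ε < α → List Ord
        rungsBelow ε<α = proj₁ (rungs (proj₁ (rung-cofinal ε ε<α)))

        rungsBelow-bounded : ∀ ε<α → All (_< ε) (rungsBelow ε<α)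
        rungsBelow-bounded ε<α = proj₁ (proj₂ (rungs (proj₁ (rung-cofinal ε ε<α))))

        rungsBelow-sound : ∀ ε<α {β} → β ∈ˡ rungsBelow ε<α → ∃[ m ] rung m ≡ β
        rungsBelow-sound ε<α = proj₁ (proj₂ (proj₂ (rungs (proj₁ (rung-cofinal ε ε<α)))))

        rungsBelow-complete : ∀ ε<α {m} → rung m < ε → rung m ∈ˡ rungsBelow ε<α
        rungsBelow-complete ε<α xm<ε = let n , ε<xn = rung-cofinal ε ε<α in
          proj₂ (proj₂ (proj₂ (rungs n))) (LadderProperties.rung-reflects l (<-trans xm<ε ε<xn)) xm<ε

      tag : ∀ {α} → Kind α → ℕ
      tag (interval _)  = 0
      tag (ladder _ _)  = 1
      tag (climb _ _ _) = 2

      -- All points of a climb exceed ν, so for ν ≥ ε nothing lies below ε and nothing is recorded.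
      climbTrace : ∀ {α} ν → E′ α → ε < α → Dec (ν < ε) → List Ord
      climbTrace {α} ν E′α ε<α (yes _) = ν ∷ e (b α ε) ∷ cap (proj₁ (minG E′α ε<α)) ∷ []
      climbTrace     ν E′α ε<α (no _)  = []

      trace : ∀ {α} → ε < α → Kind α → List Ord
      trace {α} ε<α (interval _) = cap (proj₁ (gap α)) ∷ []
      trace ε<α (ladder _ l)     = rungsBelow l ε<α
      trace ε<α (climb ν E′α _)  = climbTrace ν E′α ε<α (dec (ν < ε))

      -- The common node at ε gives equal branches below ε. A strict minimum of the tail at γ < ε
      -- thus transfers from α to α′: later values below ε coincide, and those from ε on are
      -- controlled by the capped minimum.
      climbTrace-determines : ∀ {α α′ ν ν′} (E′α : E′ α) (E′α′ : E′ α′) (c : Climb α ν) (c′ : Climb α′ ν′)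
        (ε<α : ε < α) (ε<α′ : ε < α′) (d : Dec (ν < ε)) (d′ : Dec (ν′ < ε)) →
        climbTrace ν E′α ε<α d ≡ climbTrace ν′ E′α′ ε<α′ d′ →
        ∀ {β} → β < ε → C′ α (climb ν E′α c) β → C′ α′ (climb ν′ E′α′ c′) β
      climbTrace-determines E′α _ c _ _ _ (no ν≮ε) _ _ β<ε Cβ =
        contradiction (<-trans (ClimbProperties.ν<C E′α c Cβ) β<ε) ν≮ε
      climbTrace-determines _ _ _ _ _ _ (yes _) (no _) ()
      climbTrace-determines {α} {α′} {ν} E′α E′α′ c c′ ε<α ε<α′ (yes _) (yes _) eq with ∷-injective eq
      ... | refl , eq′ with ∷-injective eq′
      ...   | be , eq″ = go
        where
        b≡ : b α ε ≡ b α′ ε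
        b≡ = e-injective be

        cap≡ : cap (proj₁ (minG E′α ε<α)) ≡ cap (proj₁ (minG E′α′ ε<α′))
        cap≡ = proj₁ (∷-injective eq″)

        N⊆N : ∀ {β} → β < ε → N α ν β → N α′ ν β
        N⊆N {β} β<ε (γ , (Eγ , γ<α , minimal) , ν<γ , refl) =
          γ , (Eγ , γ<α′ , minimal′) , ν<γ , cong (λ x → K x ν) (sym (same γ<ε))
          where
          γ<ε : γ < ε
          γ<ε = <-trans (γ<Kb γ<α) β<ε
          γ<α′ : γ < α′
          γ<α′ = <-trans γ<ε ε<α′
          same : ∀ {ζ} → ζ < ε → b α ζ ≡ b α′ ζ
          same = b-determined ε<α ε<α′ b≡
          G<minG : G α γ < proj₁ (minG E′α ε<α)
          G<minG =
            let ζ , Eζ , ε≤ζ , ζ<α , eq = proj₁ (proj₂ (minG E′α ε<α))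
            in subst (G α γ <_) eq (minimal ζ Eζ (<-≤-trans γ<ε ε≤ζ) ζ<α)
          minimal′ : ∀ γ′ → E γ′ → γ < γ′ → γ′ < α′ → G α′ γ < G α′ γ′
          minimal′ γ′ Eγ′ γ<γ′ γ′<α′ = subst (λ x → F x < G α′ γ′) (same γ<ε) (case dec (γ′ < ε) of λ
            { (yes γ′<ε) → subst (λ x → G α γ < F x) (same γ′<ε) (minimal γ′ Eγ′ γ<γ′ (<-trans γ′<ε ε<α))
            ; (no γ′≮ε)  → <-≤-trans
                (≰⇒> λ m′≤G → ≤⇒≯ (cap-reflects (sym cap≡) (<-trans (G-< Eγ γ<α) γ<ε) m′≤G) G<minG)
                (proj₂ (proj₂ (minG E′α′ ε<α′)) _ (γ′ , Eγ′ , ≮⇒≥ γ′≮ε , γ′<α′ , refl)) })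

        go : ∀ {β} → β < ε → C′ α (climb ν E′α c) β → C′ α′ (climb ν E′α′ c′) β
        go β<ε (inj₁ n)        = inj₁ (N⊆N β<ε n)
        go β<ε (inj₂ (_ , lp)) = inj₂ (<-trans β<ε ε<α′ , LimitPoint-⊆ (λ ξ ξ<β → N⊆N (<-trans ξ<β β<ε)) lp)

      trace-determines : ∀ {α α′} (ε<α : ε < α) (ε<α′ : ε < α′) k k′ → tag k ≡ tag k′ → trace ε<α k ≡ trace ε<α′ k′ →
        ∀ {β} → β < ε → C′ α k β → C′ α′ k′ β
      trace-determines {α} {α′} _ ε<α′ (interval _) (interval _) _ eq {β} β<ε (_ , above) =
        <-trans β<ε ε<α′ , λ δ E′δ δ<α′ → ≤-trans (proj₁ (proj₂ (gap α′)) δ E′δ δ<α′)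
          (cap-reflects (proj₁ (∷-injective eq)) β<ε (proj₂ (proj₂ (gap α)) β above))
      trace-determines ε<α ε<α′ (ladder _ l) (ladder _ l′) _ eq β<ε (m , refl) =
        rungsBelow-sound l′ ε<α′ (subst (_ ∈ˡ_) eq (rungsBelow-complete l ε<α β<ε))
      trace-determines ε<α ε<α′ (climb ν E′α c) (climb ν′ E′α′ c′) _ =
        climbTrace-determines E′α E′α′ c c′ ε<α ε<α′ (dec (ν < ε)) (dec (ν′ < ε))
      trace-determines _ _ (interval _)  (ladder _ _)  ()
      trace-determines _ _ (interval _)  (climb _ _ _) ()
      trace-determines _ _ (ladder _ _)  (interval _)  ()
      trace-determines _ _ (ladder _ _)  (climb _ _ _) ()
      trace-determines _ _ (climb _ _ _) (interval _)  ()
      trace-determines _ _ (climb _ _ _) (ladder _ _)  ()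

      -- For α ≤ ε the ordinal itself is recorded; the tags of the other case are shifted by one so
      -- that 0 marks this case.
      signature : ∀ α → Dec (ε < α) → ℕ × List Ord
      signature α (yes ε<α) = suc (tag (kind α)) , trace ε<α (kind α)
      signature α (no _)    = 0 , α ∷ []

      signature-determines : ∀ {α α′} d d′ → signature α d ≡ signature α′ d′ → ∀ {β} → β < ε → C α β → C α′ β
      signature-determines {α} {α′} (yes p) (yes p′) eq =
        trace-determines p p′ (kind α) (kind α′) (Nat.suc-injective (cong proj₁ eq)) (cong proj₂ eq)
      signature-determines (no _) (no _) refl _ Cβ = Cβ

      bound : Ord
      bound = ω ∨ (s ε ∨ proj₁ (small-level ε e))

      ≤-bound : ∀ {β} → β < s ε → β < bound
      ≤-bound p = <-≤-trans p (≤-trans (≤-∨ˡ (s ε) _) (≤-∨ʳ ω _))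

      signature-bounded : ∀ α d → All (_< bound) (proj₂ (signature α d))
      signature-bounded α (no ε≮α) = ≤-bound (≤⇒<s (≮⇒≥ ε≮α)) ∷ []
      signature-bounded α (yes ε<α) = go (kind α)
        where
        goClimb : ∀ ν (E′α : E′ α) d → All (_< bound) (climbTrace ν E′α ε<α d)
        goClimb ν E′α (yes ν<ε) = ≤-bound (<-trans ν<ε (<s ε))
          ∷ <-≤-trans (proj₂ (small-level ε e) (b α ε) (ht-b ε<α)) (≤-trans (≤-∨ʳ (s ε) _) (≤-∨ʳ ω _))
          ∷ ≤-bound (cap-< _) ∷ []
        goClimb ν E′α (no _) = []
        go : ∀ k → All (_< bound) (trace ε<α k)
        go (interval _)    = ≤-bound (cap-< _) ∷ []
        go (ladder _ l)    = All.map (λ p → ≤-bound (<-trans p (<s ε))) (rungsBelow-bounded l ε<α)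
        go (climb ν E′α _) = goClimb ν E′α (dec (ν < ε))

      signatureCode : Ord → Ord
      signatureCode α = let n , l = signature α (dec (ε < α)) in code (nth n ∷ l)

      signatureCode-determines : ∀ {α α′} → signatureCode α ≡ signatureCode α′ → ∀ {β} → β < ε → C α β → C α′ β
      signatureCode-determines eq =
        let p , q = ∷-injective (code-injective eq)
        in signature-determines (dec _) (dec _) (cong₂ _,_ (increasing⇒injective nth (λ n → <s (nth n)) p) q)

      few : Size<κ κ (image (≐-setoid Ord ℓ) (λ α → C α ∩ ↓ ε))
      few = few⇒Size<κ (≐-setoid Ord ℓ) (λ α → C α ∩ ↓ ε) signatureCode
        (λ α → proj₂ (small-lists bound code) _
          (<-≤-trans (nth<ω (proj₁ (signature α (dec (ε < α))))) (≤-∨ˡ ω _) ∷ signature-bounded α (dec _)))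
        λ eq → (λ { (Cβ , β<ε) → signatureCode-determines eq β<ε Cβ , β<ε })
             , (λ { (Cβ , β<ε) → signatureCode-determines (sym eq) β<ε Cβ , β<ε })

    squareSequence : ∃[ C ] IsSquare*<Sequence κ C × ContainsClub κ (R′ κ C ∩ V′ κ C)
    squareSequence = C , record
      { isCSequence = C-isCSequence
      ; weaklyCoherent = λ ε → Coherence.few ε
      ; R-club = E′ , E′-isClub , E′⊆R
      } , E′ , E′-isClub , λ E′δ → E′⊆R′ E′δ , E′⊆V′ E′δ

theorem10p1 : (∀ a → ExcludedMiddle a) →
    ∀ {ℓ} (κ : RegularUncountableCardinal ℓ) →
    ((∃[ C ] IsSquare*<Sequence κ C × ContainsClub κ (R′ κ C ∩ V′ κ C)) ⇔ Square*< κ) ×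
    (Square*< κ ⇔ SpecialκAronszajnTree κ)
theorem10p1 em κ =
    mk⇔ (λ { (C , square , _) → C , square }) (λ square → fromTree (toTree square))
  , mk⇔ toTree (λ tree → let C , square , _ = fromTree tree in C , square)
  where
  open Development em κ
  toTree : Square*< κ → SpecialκAronszajnTree κ
  toTree (_ , square) = SquareToTree.specialTree square
  fromTree : SpecialκAronszajnTree κ → ∃[ C ] IsSquare*<Sequence κ C × ContainsClub κ (R′ κ C ∩ V′ κ C)
  fromTree (_ , _ , aronszajn , special) =
    TreeToSquare.squareSequence (IsκAronszajn.isκTree aronszajn) special
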